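{- Let $CP_3(n)$ be defined by $\sum_{n\ge 0} CP_3(n)q^n = \dfrac{f_3^6f_6^6}{f_1^2f_2^2}$. Then for all integers $k\ge 1$ and $n\ge 1$, \[ CP_3(2\cdot 3^kn+3^k-2)\equiv 0\pmod{2\cdot 3^{k-1}}. \]
   Context: For $|q|<1$ and integer $m\ge 1$, $f_m := (q^m;q^m)_\infty=\prod_{n\ge1}(1-q^{mn})$. $CP_3(n)$ is the number of $3$-core cubic bipartitions of $n$, defined by the generating function $\sum_{n\ge0}CP_3(n)q^n = \frac{f_3^6f_6^6}{f_1^2f_2^2}$. -}

module Defs where

open import Data.Nat using (ℕ; zero; suc; _*_; _∸_; _<ᵇ_; _/_; NonZero)
open import Data.Integer using (ℤ; _+_; _-_; 0ℤ; 1ℤ)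
open import Data.Bool using (if_then_else_)
open import Data.List using (List; foldr; map; upTo)

Series : Set
Series = ℕ → ℤ

one : Series
one zero    = 1ℤ
one (suc _) = 0ℤ

mulOneMinus : ℕ → Series → Series
mulOneMinus k a i = if i <ᵇ k then a i else (a i - a (i ∸ k))

-- multiplication by 1/(1 - q^(suc k)) = Σ_j q^(j(k+1)):  b_i = Σ_{j=0}^{⌊i/(k+1)⌋} a_{i - j(k+1)}
divOneMinus : ℕ → Series → Series
divOneMinus k a i = foldr _+_ 0ℤ (map (λ j → a (i ∸ j * suc k)) (upTo (suc (i / suc k))))

iter : ℕ → (Series → Series) → Series → Series
iter zero    g s = s
iter (suc e) g s = g (iter e g s)

-- multiply by f_m^e = ∏_{n≥1} (1 - q^{mn})^e, where only the factors with n ≤ N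
-- are applied (those with mn > N do not affect coefficients of index ≤ N when m ≥ 1)
mulEta : (N m e : ℕ) → Series → Series
mulEta N m e s = foldr (λ n t → iter e (mulOneMinus (suc n * m)) t) s (upTo N)

-- multiply by f_{m+1}^{-e} = ∏_{n≥1} (1 - q^{(m+1)n})^{-e}, factors with n ≤ N
divEta : (N m e : ℕ) → Series → Series
divEta N m e s = foldr (λ n t → iter e (divOneMinus (suc n * suc m ∸ 1)) t) s (upTo N)

CP3 : ℕ → ℤ
CP3 n = mulEta n 3 6 (mulEta n 6 6 (divEta n 0 2 (divEta n 1 2 one))) n

{-# OPTIONS --safe #-}

-- Put h = f₁f₂ and g = f₃f₆. The series G = q²g⁶/h² = ∑ CP₃(n) qⁿ⁺² and S = q h²g² are modular
-- forms of weight 4 and level 6; S is a cusp form, and 15 G + S is an Eisenstein series. On the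
-- operator U₃ : ∑ aₙqⁿ ↦ ∑ a₃ₙqⁿ this gives U₃ S = -3 S and U₃ G = 27 G + 2 S, whence by induction
-- 3ᵏ divides the coefficients of G at all multiples of 3ᵏ⁺¹. The remaining factor 2 is a matter of
-- parity: ∑ CP₃(n) qⁿ is the square of g³/h, so its odd coefficients are even.
--
-- The two identities are proved without modular forms from two facts about the 3-dissection
-- h = a(q³) - q g(q³) + q² c(q³): the relation ac = -2g², and the product formula ν g = h⁴ for the
-- norm ν = a³ - q g³ + q² c³ + 3q agc. The dissection comes from h = φ(-q) ψ(q) and the
-- Jacobi triple product.
module Submission where

open import Defs
open import Data.Nat using (ℕ; zero; suc; _+_; _*_; _∸_; _^_; _≤_; _<_; _<ᵇ_; z≤n; s≤s; NonZero)
import Data.Nat as ℕ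
import Data.Nat.DivMod as DivMod
import Data.Nat.Properties as ℕₚ
open import Data.Nat.Solver using () renaming (module +-*-Solver to ℕSolver)
open import Data.Integer using (ℤ; +_; -[1+_]; 0ℤ; 1ℤ; -1ℤ)
import Data.Integer as ℤ
open import Data.Integer.Divisibility using (_∣_)
import Data.Integer.Divisibility.Signed as Signed
import Data.Integer.Properties as ℤₚ
open import Data.Integer.Solver using () renaming (module +-*-Solver to ℤSolver)
open import Data.Bool using (true; false; if_then_else_; T)
open import Data.List using (foldr; upTo; applyUpTo)
import Data.List.Properties as Listₚ
open import Data.Maybe using (Maybe; just; nothing)
open import Data.Product using (∃; _,_; proj₁; proj₂)
open import Data.Sum using (_⊎_; inj₁; inj₂)
open import Function using (_∘_)
open import Relation.Nullary using (yes; no)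
open import Relation.Binary.PropositionalEquality
import Relation.Binary.Reasoning.Setoid as SetoidReasoning
open import Algebra.Bundles using (AbelianGroup; CommutativeRing)
open import Algebra.Properties.Group (AbelianGroup.group ℤₚ.+-0-abelianGroup) using (∙-cancelʳ)
import Algebra.Properties.CommutativeSemiring.Exp as Exp
open import Algebra.Solver.Ring.AlmostCommutativeRing
  using (fromCommutativeRing; _-Raw-AlmostCommutative⟶_)
import Algebra.Solver.Ring as RingSolver

-- The ring ℤ[[q]]

-- The obstacle is the factor 1/h² in G, since U₃ does not respect products. It does commute with
-- multiplication by series in q³, and g = h(q³) makes the numerator g⁶ such a series. Multiplying h
-- by its conjugates under q ↦ ωq turns it into ν(q³), so U₃ G reduces to one component of the
-- square of the product of the conjugates, a polynomial in q, a, g, c. The relation ac = -2g² is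
-- what collapses this polynomial to g⁴ and gν, that is, to G and S. It holds because a and c are
-- the outer coefficients of a product of two binomials, and their four factors regroup into φψ and
-- Ωf(q,q²), which are eta products.
--
-- Each application of U₃ gains only one factor 3 on S. The term 2S, not 27G, is therefore what
-- limits the power of 3 in G, and G lags one step behind S.
--
-- For the index N of the theorem, N + 2 = (2n+1)3ᵏ, so N + 2 is a multiple of 3ᵏ and N is odd; both
-- divisibilities apply to the same coefficient.
--
-- Identities between quotients are stated with cleared denominators, and factors with constant term
-- 1 are cancelled.

infix  4 _≈_
infixl 6 _⊕_
infixl 7 _⊛_
infix  8 ⊖_

-- A record rather than a bare pointwise statement, so that the two series can be inferred from the
-- type of a proof.
record _≈_ (a b : Series) : Set where
  constructor coeffs
  field at : ∀ i → a i ≡ b i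
open _≈_

const : ℤ → Series
const x zero    = x
const x (suc _) = 0ℤ

tail : Series → Series
tail a i = a (suc i)

_⊕_ : Series → Series → Series
(a ⊕ b) i = a i ℤ.+ b i

⊖_ : Series → Series
(⊖ a) i = ℤ.- a i

-- The Cauchy product, by recursion along a = a₀ + q · `tail a` in the left factor.
_⊛_ : Series → Series → Series
(a ⊛ b) zero    = a 0 ℤ.* b 0
(a ⊛ b) (suc n) = a 0 ℤ.* b (suc n) ℤ.+ (tail a ⊛ b) n

⊛-cong-upto : ∀ {a a' b b'} n → (∀ i → i ≤ n → a i ≡ a' i) → (∀ i → i ≤ n → b i ≡ b' i) →
              (a ⊛ b) n ≡ (a' ⊛ b') n
⊛-cong-upto zero p r = cong₂ ℤ._*_ (p 0 z≤n) (r 0 z≤n)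
⊛-cong-upto (suc n) p r = cong₂ ℤ._+_
  (cong₂ ℤ._*_ (p 0 z≤n) (r (suc n) ℕₚ.≤-refl))
  (⊛-cong-upto n (λ i h → p (suc i) (s≤s h)) (λ i h → r i (ℕₚ.m≤n⇒m≤1+n h)))

-- The mirror image of the defining recursion. Together the two give commutativity, and they allow
-- both ends of a convolution to be peeled off.
⊛-sucʳ : ∀ a b n → (a ⊛ b) (suc n) ≡ a (suc n) ℤ.* b 0 ℤ.+ (a ⊛ tail b) n
⊛-sucʳ a b zero = ℤₚ.+-comm (a 0 ℤ.* b 1) (a 1 ℤ.* b 0)
⊛-sucʳ a b (suc n) = trans
  (cong (λ w → a 0 ℤ.* b (suc (suc n)) ℤ.+ w) (⊛-sucʳ (tail a) b n))
  (solve 3 (λ x y z → x :+ (y :+ z) := y :+ (x :+ z)) refl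
    (a 0 ℤ.* b (suc (suc n))) (a (suc (suc n)) ℤ.* b 0) ((tail a ⊛ tail b) n))
  where open ℤSolver

private

  ⊛-comm : ∀ a b n → (a ⊛ b) n ≡ (b ⊛ a) n
  ⊛-comm a b zero = ℤₚ.*-comm (a 0) (b 0)
  ⊛-comm a b (suc n) = trans
    (cong₂ ℤ._+_ (ℤₚ.*-comm (a 0) (b (suc n))) (⊛-comm (tail a) b n))
    (sym (⊛-sucʳ b a n))

  ⊛-distribʳ : ∀ c a b n → ((a ⊕ b) ⊛ c) n ≡ (a ⊛ c) n ℤ.+ (b ⊛ c) n
  ⊛-distribʳ c a b zero = ℤₚ.*-distribʳ-+ (c 0) (a 0) (b 0)
  ⊛-distribʳ c a b (suc n) = trans
    (cong (λ w → (a 0 ℤ.+ b 0) ℤ.* c (suc n) ℤ.+ w) (⊛-distribʳ c (tail a) (tail b) n))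
    (solve 5 (λ a b c x y → (a :+ b) :* c :+ (x :+ y) := (a :* c :+ x) :+ (b :* c :+ y)) refl
      (a 0) (b 0) (c (suc n)) ((tail a ⊛ c) n) ((tail b ⊛ c) n))
    where open ℤSolver

  ⊛-scaleˡ : ∀ x a b n → ((λ i → x ℤ.* a i) ⊛ b) n ≡ x ℤ.* (a ⊛ b) n
  ⊛-scaleˡ x a b zero = ℤₚ.*-assoc x (a 0) (b 0)
  ⊛-scaleˡ x a b (suc n) = trans
    (cong (λ w → x ℤ.* a 0 ℤ.* b (suc n) ℤ.+ w) (⊛-scaleˡ x (tail a) b n))
    (solve 4 (λ x a b c → x :* a :* b :+ x :* c := x :* (a :* b :+ c)) refl
      x (a 0) (b (suc n)) ((tail a ⊛ b) n))
    where open ℤSolver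

  ⊛-assoc : ∀ a b c n → ((a ⊛ b) ⊛ c) n ≡ (a ⊛ (b ⊛ c)) n
  ⊛-assoc a b c zero = ℤₚ.*-assoc (a 0) (b 0) (c 0)
  ⊛-assoc a b c (suc n) = begin
    a 0 ℤ.* b 0 ℤ.* c (suc n) ℤ.+ (tail (a ⊛ b) ⊛ c) n
      ≡⟨ cong (λ w → a 0 ℤ.* b 0 ℤ.* c (suc n) ℤ.+ w)
           (⊛-cong-upto {b = c} n (λ _ _ → refl) (λ _ _ → refl)) ⟩
    a 0 ℤ.* b 0 ℤ.* c (suc n) ℤ.+ (((λ i → a 0 ℤ.* b (suc i)) ⊕ (tail a ⊛ b)) ⊛ c) n
      ≡⟨ cong (λ w → a 0 ℤ.* b 0 ℤ.* c (suc n) ℤ.+ w) (⊛-distribʳ c (λ i → a 0 ℤ.* b (suc i)) (tail a ⊛ b) n) ⟩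
    a 0 ℤ.* b 0 ℤ.* c (suc n) ℤ.+ (((λ i → a 0 ℤ.* b (suc i)) ⊛ c) n ℤ.+ ((tail a ⊛ b) ⊛ c) n)
      ≡⟨ cong (λ w → a 0 ℤ.* b 0 ℤ.* c (suc n) ℤ.+ w)
           (cong₂ ℤ._+_ (⊛-scaleˡ (a 0) (tail b) c n) (⊛-assoc (tail a) b c n)) ⟩
    a 0 ℤ.* b 0 ℤ.* c (suc n) ℤ.+ (a 0 ℤ.* (tail b ⊛ c) n ℤ.+ (tail a ⊛ (b ⊛ c)) n)
      ≡⟨ solve 5 (λ a b c x y → a :* b :* c :+ (a :* x :+ y) := a :* (b :* c :+ x) :+ y) refl
           (a 0) (b 0) (c (suc n)) ((tail b ⊛ c) n) ((tail a ⊛ (b ⊛ c)) n) ⟩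
    a 0 ℤ.* (b ⊛ c) (suc n) ℤ.+ (tail a ⊛ (b ⊛ c)) n ∎
    where
    open ≡-Reasoning
    open ℤSolver

  ⊛-zeroˡ : ∀ b n → (const 0ℤ ⊛ b) n ≡ 0ℤ
  ⊛-zeroˡ b zero = refl
  ⊛-zeroˡ b (suc n) = trans
    (ℤₚ.+-identityˡ ((tail (const 0ℤ) ⊛ b) n))
    (trans (⊛-cong-upto {b = b} n (λ { zero _ → refl ; (suc _) _ → refl }) (λ _ _ → refl)) (⊛-zeroˡ b n))

const-⊛ : ∀ x b n → (const x ⊛ b) n ≡ x ℤ.* b n
const-⊛ x b zero = refl
const-⊛ x b (suc n) = trans
  (cong (λ w → x ℤ.* b (suc n) ℤ.+ w)
    (trans (⊛-cong-upto {b = b} n (λ { zero _ → refl ; (suc _) _ → refl }) (λ _ _ → refl)) (⊛-zeroˡ b n)))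
  (ℤₚ.+-identityʳ _)

const-0 : ∀ i → const 0ℤ i ≡ 0ℤ
const-0 zero    = refl
const-0 (suc i) = refl

seriesRing : CommutativeRing _ _
seriesRing = record
  { Carrier = Series ; _≈_ = _≈_ ; _+_ = _⊕_ ; _*_ = _⊛_ ; -_ = ⊖_ ; 0# = const 0ℤ ; 1# = const 1ℤ
  ; isCommutativeRing = record
    { isRing = record
      { +-isAbelianGroup = record
        { isGroup = record
          { isMonoid = record
            { isSemigroup = record
              { isMagma = record
                { isEquivalence = record
                  { refl = coeffs λ _ → refl
                  ; sym = λ p → coeffs λ i → sym (at p i)
                  ; trans = λ p r → coeffs λ i → trans (at p i) (at r i) }
                ; ∙-cong = λ p r → coeffs λ i → cong₂ ℤ._+_ (at p i) (at r i) }
              ; assoc = λ a b c → coeffs λ i → ℤₚ.+-assoc (a i) (b i) (c i) }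
            ; identity = (λ a → coeffs λ i → trans (cong (ℤ._+ a i) (const-0 i)) (ℤₚ.+-identityˡ _))
                       , (λ a → coeffs λ i → trans (cong (λ w → a i ℤ.+ w) (const-0 i)) (ℤₚ.+-identityʳ _)) }
          ; inverse = (λ a → coeffs λ i → trans (ℤₚ.+-inverseˡ (a i)) (sym (const-0 i)))
                    , (λ a → coeffs λ i → trans (ℤₚ.+-inverseʳ (a i)) (sym (const-0 i)))
          ; ⁻¹-cong = λ p → coeffs λ i → cong ℤ.-_ (at p i) }
        ; comm = λ a b → coeffs λ i → ℤₚ.+-comm (a i) (b i) }
      ; *-cong = λ p r → coeffs λ n → ⊛-cong-upto n (λ i _ → at p i) (λ i _ → at r i)
      ; *-assoc = λ a b c → coeffs (⊛-assoc a b c)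
      ; *-identity = oneˡ , (λ a → coeffs λ n → trans (⊛-comm a (const 1ℤ) n) (at (oneˡ a) n))
      ; distrib = (λ c a b → coeffs λ n → trans (⊛-comm c (a ⊕ b) n)
                     (trans (⊛-distribʳ c a b n) (cong₂ ℤ._+_ (⊛-comm a c n) (⊛-comm b c n))))
                , (λ c a b → coeffs (⊛-distribʳ c a b)) }
    ; *-comm = λ a b → coeffs (⊛-comm a b) } }
  where
  oneˡ : ∀ a → (const 1ℤ ⊛ a) ≈ a
  oneˡ a = coeffs λ n → trans (const-⊛ 1ℤ a n) (ℤₚ.*-identityˡ (a n))

module R = CommutativeRing seriesRing

private
  constHom : CommutativeRing.rawRing ℤₚ.+-*-commutativeRing -Raw-AlmostCommutative⟶ fromCommutativeRing seriesRing
  constHom = record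
    { ⟦_⟧ = const
    ; +-homo = λ x y → coeffs λ { zero → refl ; (suc _) → refl }
    ; *-homo = λ x y → coeffs λ n → sym (trans (const-⊛ x (const y) n) (lem x y n))
    ; -‿homo = λ x → coeffs λ { zero → refl ; (suc _) → refl }
    ; 0-homo = R.refl
    ; 1-homo = R.refl }
    where
    lem : ∀ x y n → x ℤ.* const y n ≡ const (x ℤ.* y) n
    lem x y zero = refl
    lem x y (suc n) = ℤₚ.*-zeroʳ x

  const-≟ : ∀ x y → Maybe (const x ≈ const y)
  const-≟ x y with x ℤ.≟ y
  ... | yes refl = just R.refl
  ... | no _     = nothing

module Solver = RingSolver (CommutativeRing.rawRing ℤₚ.+-*-commutativeRing) (fromCommutativeRing seriesRing)
  constHom const-≟

-- Congruences modulo powers of q, limits and 3-dissections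

module ≈-Reasoning = SetoidReasoning R.setoid

0# 1# : Series
0# = const 0ℤ
1# = const 1ℤ

⊛-congˡ : ∀ {a b} c → a ≈ b → a ⊛ c ≈ b ⊛ c
⊛-congˡ c p = R.*-cong p R.refl

⊛-congʳ : ∀ {a b} c → a ≈ b → c ⊛ a ≈ c ⊛ b
⊛-congʳ c p = R.*-cong (R.refl {c}) p

⊕-congˡ : ∀ {a b} c → a ≈ b → a ⊕ c ≈ b ⊕ c
⊕-congˡ c p = R.+-cong p (R.refl {c})

⊕-congʳ : ∀ {a b} c → a ≈ b → c ⊕ a ≈ c ⊕ b
⊕-congʳ c p = R.+-cong (R.refl {c}) p

infix 4 _≈[_]_

record _≈[_]_ (a : Series) (M : ℕ) (b : Series) : Set where
  constructor coeffs<
  field at< : ∀ i → i < M → a i ≡ b i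
open _≈[_]_

≈⇒≈[] : ∀ {a b} M → a ≈ b → a ≈[ M ] b
≈⇒≈[] M p = coeffs< λ i _ → at p i

≈[]⇒≈ : ∀ {a b} → (∀ M → a ≈[ M ] b) → a ≈ b
≈[]⇒≈ p = coeffs λ i → at< (p (suc i)) i ℕₚ.≤-refl

≈[]-refl : ∀ {a M} → a ≈[ M ] a
≈[]-refl = coeffs< λ _ _ → refl

≈[]-sym : ∀ {a b M} → a ≈[ M ] b → b ≈[ M ] a
≈[]-sym p = coeffs< λ i h → sym (at< p i h)

≈[]-trans : ∀ {a b c M} → a ≈[ M ] b → b ≈[ M ] c → a ≈[ M ] c
≈[]-trans p r = coeffs< λ i h → trans (at< p i h) (at< r i h)

≈[]-mono : ∀ {a b M N} → M ≤ N → a ≈[ N ] b → a ≈[ M ] b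
≈[]-mono M≤N p = coeffs< λ i h → at< p i (ℕₚ.≤-trans h M≤N)

⊕-cong[] : ∀ {a a' b b' M} → a ≈[ M ] a' → b ≈[ M ] b' → a ⊕ b ≈[ M ] a' ⊕ b'
⊕-cong[] p r = coeffs< λ i h → cong₂ ℤ._+_ (at< p i h) (at< r i h)

⊖-cong[] : ∀ {a a' M} → a ≈[ M ] a' → ⊖ a ≈[ M ] ⊖ a'
⊖-cong[] p = coeffs< λ i h → cong ℤ.-_ (at< p i h)

⊛-cong[] : ∀ {a a' b b' M} → a ≈[ M ] a' → b ≈[ M ] b' → a ⊛ b ≈[ M ] a' ⊛ b'
⊛-cong[] p r = coeffs< λ n h → ⊛-cong-upto n
  (λ i i≤n → at< p i (ℕₚ.≤-<-trans i≤n h)) (λ i i≤n → at< r i (ℕₚ.≤-<-trans i≤n h))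

-- Divisibility of a by qᵏ adds k to the precision of a congruence. This gain drives both the
-- inversion of series and the limit in the triple product.
⊛-cong[+] : ∀ {a x y} k {l} → a ≈[ k ] 0# → x ≈[ l ] y → a ⊛ x ≈[ k ℕ.+ l ] a ⊛ y
⊛-cong[+] zero p r = ⊛-cong[] ≈[]-refl r
⊛-cong[+] {a} {x} {y} (suc k) {l} p r = coeffs< λ
  { zero _ → trans (cong (ℤ._* x 0) a₀≡0) (cong (ℤ._* y 0) (sym a₀≡0))
  ; (suc n) (s≤s h) → cong₂ ℤ._+_
      (trans (cong (ℤ._* x (suc n)) a₀≡0) (cong (ℤ._* y (suc n)) (sym a₀≡0)))
      (at< (⊛-cong[+] k {l} tail-p r) n h) }
  where
  a₀≡0 : a 0 ≡ 0ℤ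
  a₀≡0 = at< p 0 (s≤s z≤n)
  tail-p : tail a ≈[ k ] 0#
  tail-p = coeffs< λ i h → trans (at< p (suc i) (s≤s h)) (sym (const-0 i))

-- Induction on the precision: once x and y agree below M, coefficient M of the two products can
-- differ only through a₀ times coefficient M of x and y.
⊛-cancel[] : ∀ {a x y} → a 0 ≡ 1ℤ → ∀ M → a ⊛ x ≈[ M ] a ⊛ y → x ≈[ M ] y
⊛-cancel[] a₀ zero p = coeffs< λ _ ()
⊛-cancel[] {a} {x} {y} a₀ (suc M) p = coeffs< λ i h → step i (ℕₚ.m≤n⇒m<n∨m≡n (ℕₚ.≤-pred h))
  where
  rec : x ≈[ M ] y
  rec = ⊛-cancel[] a₀ M (≈[]-mono (ℕₚ.n≤1+n M) p)
  unit : ∀ w → a 0 ℤ.* w ≡ w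
  unit w = trans (cong (ℤ._* w) a₀) (ℤₚ.*-identityˡ w)
  top : ∀ M → x ≈[ M ] y → (a ⊛ x) M ≡ (a ⊛ y) M → x M ≡ y M
  top zero _ e = trans (sym (unit (x 0))) (trans e (unit (y 0)))
  top (suc n) r e = trans (sym (unit _)) (trans
    (∙-cancelʳ ((tail a ⊛ x) n) _ _ (trans e (cong (λ w → a 0 ℤ.* y (suc n) ℤ.+ w)
      (sym (at< (⊛-cong[] {tail a} ≈[]-refl r) n ℕₚ.≤-refl)))))
    (unit _))
  step : ∀ i → (i < M ⊎ i ≡ M) → x i ≡ y i
  step i (inj₁ i<M) = at< rec i i<M
  step i (inj₂ refl) = top M rec (at< p M ℕₚ.≤-refl)

⊛-cancel : ∀ {a x y} → a 0 ≡ 1ℤ → a ⊛ x ≈ a ⊛ y → x ≈ y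
⊛-cancel a₀ p = ≈[]⇒≈ λ M → ⊛-cancel[] a₀ M (≈⇒≈[] M p)

mono : ℤ → ℕ → Series
mono x zero    = const x
mono x (suc e) zero    = 0ℤ
mono x (suc e) (suc i) = mono x e i

mono-⊛-suc : ∀ x e a n → (mono x (suc e) ⊛ a) (suc n) ≡ (mono x e ⊛ a) n
mono-⊛-suc x e a n = ℤₚ.+-identityˡ ((mono x e ⊛ a) n)

mono-⊛ : ∀ x e y f → mono x e ⊛ mono y f ≈ mono (x ℤ.* y) (e ℕ.+ f)
mono-⊛ x e y f = coeffs (go e)
  where
  const-mono : ∀ f n → x ℤ.* mono y f n ≡ mono (x ℤ.* y) f n
  const-mono zero zero = refl
  const-mono zero (suc n) = ℤₚ.*-zeroʳ x
  const-mono (suc f) zero = ℤₚ.*-zeroʳ x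
  const-mono (suc f) (suc n) = const-mono f n
  go : ∀ e n → (mono x e ⊛ mono y f) n ≡ mono (x ℤ.* y) (e ℕ.+ f) n
  go zero n = trans (const-⊛ x (mono y f) n) (const-mono f n)
  go (suc e) zero = refl
  go (suc e) (suc n) = trans (mono-⊛-suc x e (mono y f) n) (go e n)

mono-small : ∀ x {e M} → M ≤ e → mono x e ≈[ M ] 0#
mono-small x {e} {M} M≤e = coeffs< λ i h → trans (go e i (ℕₚ.≤-trans h M≤e)) (sym (const-0 i))
  where
  go : ∀ e i → i < e → mono x e i ≡ 0ℤ
  go (suc e) zero _ = refl
  go (suc e) (suc i) (s≤s h) = go e i h

≡⇒≈ : ∀ {a b} → a ≡ b → a ≈ b
≡⇒≈ refl = R.refl

q : Series
q = mono 1ℤ 1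

-- limits in the q-adic topology, with the rate s N ≡ a (mod q^N) built in
infix 4 _⟶_

record _⟶_ (s : ℕ → Series) (a : Series) : Set where
  constructor converges
  field mod-q^ : ∀ M N → M ≤ N → s N ≈[ M ] a
open _⟶_

⟶-const : ∀ a → (λ _ → a) ⟶ a
⟶-const a = converges λ M N _ → ≈[]-refl

⟶-⊕ : ∀ {s t a b} → s ⟶ a → t ⟶ b → (λ N → s N ⊕ t N) ⟶ a ⊕ b
⟶-⊕ p r = converges λ M N h → ⊕-cong[] (mod-q^ p M N h) (mod-q^ r M N h)

⟶-⊖ : ∀ {s a} → s ⟶ a → (λ N → ⊖ s N) ⟶ ⊖ a
⟶-⊖ p = converges λ M N h → ⊖-cong[] (mod-q^ p M N h)

⟶-⊛ : ∀ {s t a b} → s ⟶ a → t ⟶ b → (λ N → s N ⊛ t N) ⟶ a ⊛ b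
⟶-⊛ p r = converges λ M N h → ⊛-cong[] (mod-q^ p M N h) (mod-q^ r M N h)

⟶-subseq : ∀ {s a} (ρ : ℕ → ℕ) → (∀ N → N ≤ ρ N) → s ⟶ a → (λ N → s (ρ N)) ⟶ a
⟶-subseq ρ ρ≥ p = converges λ M N h → mod-q^ p M (ρ N) (ℕₚ.≤-trans h (ρ≥ N))

⟶-cong : ∀ {s t a} → (∀ N → t N ≈ s N) → s ⟶ a → t ⟶ a
⟶-cong e p = converges λ M N h → ≈[]-trans (≈⇒≈[] M (e N)) (mod-q^ p M N h)

⟶-unique : ∀ {s a b} → s ⟶ a → s ⟶ b → a ≈ b
⟶-unique p r = ≈[]⇒≈ λ M → ≈[]-trans (≈[]-sym (mod-q^ p M M ℕₚ.≤-refl)) (mod-q^ r M M ℕₚ.≤-refl)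

-- Coefficient i is read at the first stage from which the Cauchy condition of `lim-⟶` keeps it
-- fixed.
lim : (ℕ → Series) → Series
lim s i = s (suc i) i

lim-⟶ : ∀ {s} → (∀ N → s (suc N) ≈[ N ] s N) → s ⟶ lim s
lim-⟶ {s} cauchy = converges λ M N M≤N → coeffs< λ i i<M → go i N (ℕₚ.≤-trans i<M M≤N)
  where
  go : ∀ i N → suc i ≤ N → s N i ≡ s (suc i) i
  go i (suc N) h with ℕₚ.m≤n⇒m<n∨m≡n h
  ... | inj₁ (s≤s i<N) = trans (at< (cauchy N) i i<N) (go i N i<N)
  ... | inj₂ refl = refl

-- Finite sums and their splitting by residue classes

sum : ℕ → (ℕ → Series) → Series
sum zero f = 0#
sum (suc N) f = sum N f ⊕ f N

sum-cong : ∀ {f g} N → (∀ k → f k ≈ g k) → sum N f ≈ sum N g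
sum-cong zero p = R.refl
sum-cong (suc N) p = R.+-cong (sum-cong N p) (p N)

sum-⊛ : ∀ N x f → x ⊛ sum N f ≈ sum N (λ k → x ⊛ f k)
sum-⊛ zero x f = R.zeroʳ x
sum-⊛ (suc N) x f = R.trans (R.distribˡ x (sum N f) (f N)) (⊕-congˡ (x ⊛ f N) (sum-⊛ N x f))

sum-head : ∀ N f → sum (suc N) f ≈ f 0 ⊕ sum N (λ k → f (suc k))
sum-head zero f = R.+-comm 0# (f 0)
sum-head (suc N) f = R.trans (⊕-congˡ (f (suc N)) (sum-head N f)) (R.+-assoc (f 0) (sum N (λ k → f (suc k))) (f (suc N)))

sum-2 : ∀ N f → sum (N ℕ.* 2) f ≈ sum N (λ k → f (k ℕ.* 2)) ⊕ sum N (λ k → f (1 ℕ.+ k ℕ.* 2))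
sum-2 zero f = R.sym (R.+-identityʳ 0#)
sum-2 (suc N) f = R.trans
  (⊕-congˡ (f (1 ℕ.+ N ℕ.* 2)) (⊕-congˡ (f (N ℕ.* 2)) (sum-2 N f)))
  (solve 4 (λ s t x y → s :+ t :+ x :+ y := s :+ x :+ (t :+ y)) R.refl
    (sum N (λ k → f (k ℕ.* 2))) (sum N (λ k → f (1 ℕ.+ k ℕ.* 2))) (f (N ℕ.* 2)) (f (1 ℕ.+ N ℕ.* 2)))
  where open Solver

sum-3 : ∀ N f → sum (N ℕ.* 3) f ≈
  sum N (λ k → f (k ℕ.* 3)) ⊕ sum N (λ k → f (1 ℕ.+ k ℕ.* 3)) ⊕ sum N (λ k → f (2 ℕ.+ k ℕ.* 3))
sum-3 zero f = solve 0 (con 0ℤ := con 0ℤ :+ con 0ℤ :+ con 0ℤ) R.refl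
  where open Solver
sum-3 (suc N) f = R.trans
  (⊕-congˡ (f (2 ℕ.+ N ℕ.* 3)) (⊕-congˡ (f (1 ℕ.+ N ℕ.* 3)) (⊕-congˡ (f (N ℕ.* 3)) (sum-3 N f))))
  (solve 6 (λ s t u x y z → s :+ t :+ u :+ x :+ y :+ z := s :+ x :+ (t :+ y) :+ (u :+ z)) R.refl
    (sum N (λ k → f (k ℕ.* 3))) (sum N (λ k → f (1 ℕ.+ k ℕ.* 3))) (sum N (λ k → f (2 ℕ.+ k ℕ.* 3)))
    (f (N ℕ.* 3)) (f (1 ℕ.+ N ℕ.* 3)) (f (2 ℕ.+ N ℕ.* 3)))
  where open Solver

-- the substitution q ↦ q³
V : Series → Series
V a zero = a 0
V a (suc zero) = 0ℤ
V a (suc (suc zero)) = 0ℤ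
V a (suc (suc (suc n))) = V (tail a) n

U : ℕ → Series → Series
U r a n = a (n ℕ.* 3 ℕ.+ r)

U-cong : ∀ r {a b} → a ≈ b → U r a ≈ U r b
U-cong r p = coeffs λ n → at p (n ℕ.* 3 ℕ.+ r)

U-⊕ : ∀ r a b → U r (a ⊕ b) ≈ U r a ⊕ U r b
U-⊕ r a b = coeffs λ _ → refl

≈-from-U : ∀ {a b} → U 0 a ≈ U 0 b → U 1 a ≈ U 1 b → U 2 a ≈ U 2 b → a ≈ b
≈-from-U {a} {b} p₀ p₁ p₂ = coeffs (go a b (at p₀) (at p₁) (at p₂))
  where
  go : ∀ a b → (∀ n → U 0 a n ≡ U 0 b n) → (∀ n → U 1 a n ≡ U 1 b n) → (∀ n → U 2 a n ≡ U 2 b n) → ∀ n → a n ≡ b n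
  go a b p₀ p₁ p₂ zero = p₀ 0
  go a b p₀ p₁ p₂ (suc zero) = p₁ 0
  go a b p₀ p₁ p₂ (suc (suc zero)) = p₂ 0
  go a b p₀ p₁ p₂ (suc (suc (suc n))) = go (λ i → a (3 ℕ.+ i)) (λ i → b (3 ℕ.+ i))
    (λ n → p₀ (suc n)) (λ n → p₁ (suc n)) (λ n → p₂ (suc n)) n

V-cong : ∀ {a b} → a ≈ b → V a ≈ V b
V-cong p = coeffs (go _ _ (at p))
  where
  go : ∀ a b → (∀ i → a i ≡ b i) → ∀ n → V a n ≡ V b n
  go a b p zero = p 0
  go a b p (suc zero) = refl
  go a b p (suc (suc zero)) = refl
  go a b p (suc (suc (suc n))) = go (tail a) (tail b) (λ i → p (suc i)) n

V-cong[] : ∀ {a b M} → a ≈[ M ] b → V a ≈[ M ] V b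
V-cong[] p = coeffs< (go _ _ _ (at< p))
  where
  go : ∀ M a b → (∀ i → i < M → a i ≡ b i) → ∀ n → n < M → V a n ≡ V b n
  go M a b p zero h = p 0 h
  go M a b p (suc zero) h = refl
  go M a b p (suc (suc zero)) h = refl
  go (suc M) a b p (suc (suc (suc n))) (s≤s h) =
    go M (tail a) (tail b) (λ i i<M → p (suc i) (s≤s i<M)) n (ℕₚ.≤-trans (ℕₚ.m≤n+m (suc n) 2) h)

⟶-V : ∀ {s a} → s ⟶ a → (λ N → V (s N)) ⟶ V a
⟶-V p = converges λ M N h → V-cong[] (mod-q^ p M N h)

-- The first M coefficients of `U r a` come from the first 3M coefficients of a, so the sequence is
-- sampled at multiples of 3 to keep the rate of convergence.
⟶-U : ∀ r → r < 3 → ∀ {s a} → s ⟶ a → (λ N → U r (s (N ℕ.* 3))) ⟶ U r a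
⟶-U r r<3 p = converges λ M N h → coeffs< λ i i<M →
  at< (mod-q^ p (M ℕ.* 3) (N ℕ.* 3) (ℕₚ.*-monoˡ-≤ 3 h)) (i ℕ.* 3 ℕ.+ r)
    (≤< i M i<M)
  where
  ≤< : ∀ i M → i < M → i ℕ.* 3 ℕ.+ r < M ℕ.* 3
  ≤< i M i<M = ℕₚ.<-≤-trans (ℕₚ.+-monoʳ-< (i ℕ.* 3) r<3)
    (ℕₚ.≤-trans (ℕₚ.≤-reflexive (ℕₚ.+-comm (i ℕ.* 3) 3)) (ℕₚ.*-monoˡ-≤ 3 i<M))

V-⊛-step : ∀ a b m → (V a ⊛ b) (3 ℕ.+ m) ≡ a 0 ℤ.* b (3 ℕ.+ m) ℤ.+ (V (tail a) ⊛ b) m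
V-⊛-step a b m = cong (λ w → a 0 ℤ.* b (3 ℕ.+ m) ℤ.+ w)
  (trans (ℤₚ.+-identityˡ (0ℤ ℤ.+ (V (tail a) ⊛ b) m)) (ℤₚ.+-identityˡ ((V (tail a) ⊛ b) m)))

-- Multiplying by a series in q³ does not mix residue classes mod 3, so each component map is linear
-- over ℤ[[q³]].
U-V⊛ : ∀ r → r < 3 → ∀ a b → U r (V a ⊛ b) ≈ a ⊛ U r b
U-V⊛ r r<3 a b = coeffs (go a)
  where
  base : ∀ r → r < 3 → ∀ a → (V a ⊛ b) r ≡ a 0 ℤ.* b r
  base zero _ a = refl
  base (suc zero) _ a = ℤₚ.+-identityʳ (a 0 ℤ.* b 1)
  base (suc (suc zero)) _ a = ℤₚ.+-identityʳ (a 0 ℤ.* b 2)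
  base (suc (suc (suc _))) (s≤s (s≤s (s≤s ())))
  go : ∀ a n → U r (V a ⊛ b) n ≡ (a ⊛ U r b) n
  go a zero = base r r<3 a
  go a (suc n) = trans (V-⊛-step a b (n ℕ.* 3 ℕ.+ r))
    (cong (λ w → a 0 ℤ.* b (3 ℕ.+ (n ℕ.* 3 ℕ.+ r)) ℤ.+ w) (go (tail a) n))

U₀-V : ∀ a → U 0 (V a) ≈ a
U₀-V a = coeffs (go a)
  where
  go : ∀ a n → V a (n ℕ.* 3 ℕ.+ 0) ≡ a n
  go a zero = refl
  go a (suc n) = go (tail a) n

U₁-V : ∀ a → U 1 (V a) ≈ 0#
U₁-V a = coeffs λ n → trans (go a n) (sym (const-0 n))
  where
  go : ∀ a n → V a (n ℕ.* 3 ℕ.+ 1) ≡ 0ℤ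
  go a zero = refl
  go a (suc n) = go (tail a) n

U₂-V : ∀ a → U 2 (V a) ≈ 0#
U₂-V a = coeffs λ n → trans (go a n) (sym (const-0 n))
  where
  go : ∀ a n → V a (n ℕ.* 3 ℕ.+ 2) ≡ 0ℤ
  go a zero = refl
  go a (suc n) = go (tail a) n

V-⊛ : ∀ a b → V (a ⊛ b) ≈ V a ⊛ V b
V-⊛ a b = ≈-from-U
  (R.trans (U₀-V _) (R.sym (R.trans (U-V⊛ 0 (s≤s z≤n) a (V b)) (⊛-congʳ a (U₀-V b)))))
  (R.trans (U₁-V _) (R.sym (R.trans (U-V⊛ 1 (s≤s (s≤s z≤n)) a (V b)) (R.trans (⊛-congʳ a (U₁-V b)) (R.zeroʳ a)))))
  (R.trans (U₂-V _) (R.sym (R.trans (U-V⊛ 2 (s≤s (s≤s (s≤s z≤n))) a (V b)) (R.trans (⊛-congʳ a (U₂-V b)) (R.zeroʳ a)))))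

V-⊕ : ∀ a b → V (a ⊕ b) ≈ V a ⊕ V b
V-⊕ a b = coeffs (go a b)
  where
  go : ∀ a b n → V (a ⊕ b) n ≡ V a n ℤ.+ V b n
  go a b zero = refl
  go a b (suc zero) = refl
  go a b (suc (suc zero)) = refl
  go a b (suc (suc (suc n))) = go (tail a) (tail b) n

V-⊖ : ∀ a → V (⊖ a) ≈ ⊖ V a
V-⊖ a = coeffs (go a)
  where
  go : ∀ a n → V (⊖ a) n ≡ ℤ.- V a n
  go a zero = refl
  go a (suc zero) = refl
  go a (suc (suc zero)) = refl
  go a (suc (suc (suc n))) = go (tail a) n

V-const : ∀ x → V (const x) ≈ const x
V-const x = coeffs λ
  { zero → refl ; (suc zero) → refl ; (suc (suc zero)) → refl ; (suc (suc (suc n))) → V0 n }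
  where
  V0 : ∀ n → V (tail (const x)) n ≡ 0ℤ
  V0 zero = refl
  V0 (suc zero) = refl
  V0 (suc (suc zero)) = refl
  V0 (suc (suc (suc n))) = V0 n

V-mono : ∀ x e → V (mono x e) ≈ mono x (e ℕ.* 3)
V-mono x zero = V-const x
V-mono x (suc e) = coeffs λ
  { zero → refl ; (suc zero) → refl ; (suc (suc zero)) → refl ; (suc (suc (suc n))) → at (V-mono x e) n }

q⊛-suc : ∀ a n → (q ⊛ a) (suc n) ≡ a n
q⊛-suc a n = trans (mono-⊛-suc 1ℤ 0 a n) (trans (const-⊛ 1ℤ a n) (ℤₚ.*-identityˡ (a n)))

U₁-q⊛ : ∀ a → U 1 (q ⊛ a) ≈ U 0 a
U₁-q⊛ a = coeffs λ n → go n
  where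
  go : ∀ n → (q ⊛ a) (n ℕ.* 3 ℕ.+ 1) ≡ a (n ℕ.* 3 ℕ.+ 0)
  go n = trans (cong (q ⊛ a) (ℕₚ.+-suc (n ℕ.* 3) 0)) (q⊛-suc a (n ℕ.* 3 ℕ.+ 0))

U₂-q⊛ : ∀ a → U 2 (q ⊛ a) ≈ U 1 a
U₂-q⊛ a = coeffs λ n → go n
  where
  go : ∀ n → (q ⊛ a) (n ℕ.* 3 ℕ.+ 2) ≡ a (n ℕ.* 3 ℕ.+ 1)
  go n = trans (cong (q ⊛ a) (ℕₚ.+-suc (n ℕ.* 3) 1)) (q⊛-suc a (n ℕ.* 3 ℕ.+ 1))

-- Multiplication by q rotates the residue classes; only the wrap from class 2 to class 0 leaves a
-- factor q³, read as q.
U₀-q⊛ : ∀ a → U 0 (q ⊛ a) ≈ q ⊛ U 2 a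
U₀-q⊛ a = coeffs λ { zero → refl ; (suc n) → go n }
  where
  go : ∀ n → (q ⊛ a) (3 ℕ.+ (n ℕ.* 3 ℕ.+ 0)) ≡ (q ⊛ U 2 a) (suc n)
  go n = trans (q⊛-suc a (2 ℕ.+ (n ℕ.* 3 ℕ.+ 0))) (trans
    (cong a (trans (cong (2 ℕ.+_) (ℕₚ.+-identityʳ (n ℕ.* 3))) (ℕₚ.+-comm 2 (n ℕ.* 3))))
    (sym (q⊛-suc (U 2 a) n)))

-- Infinite products and the Jacobi triple product

-- The iteration x ↦ 1 + (1 - a)x, whose fixed point is 1/a. If a has constant term 1, then q
-- divides 1 - a and each step fixes one more coefficient.
approxInv : Series → ℕ → Series
approxInv a zero    = 1#
approxInv a (suc n) = 1# ⊕ (1# ⊕ ⊖ a) ⊛ approxInv a n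

inv : Series → Series
inv a = lim (approxInv a)

⊛-inverseʳ : ∀ {a} → a 0 ≡ 1ℤ → a ⊛ inv a ≈ 1#
⊛-inverseʳ {a} a₀ = begin
  a ⊛ inv a
    ≈⟨ solve 2 (λ a x → a :* x := con 1ℤ :+ (x :- (con 1ℤ :+ (con 1ℤ :- a) :* x))) R.refl a (inv a) ⟩
  1# ⊕ (inv a ⊕ ⊖ (1# ⊕ (1# ⊕ ⊖ a) ⊛ inv a))
    ≈⟨ ⊕-congʳ 1# (⊕-congˡ (⊖ (1# ⊕ (1# ⊕ ⊖ a) ⊛ inv a)) fixed) ⟩
  1# ⊕ ((1# ⊕ (1# ⊕ ⊖ a) ⊛ inv a) ⊕ ⊖ (1# ⊕ (1# ⊕ ⊖ a) ⊛ inv a))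
    ≈⟨ solve 1 (λ x → con 1ℤ :+ (x :- x) := con 1ℤ) R.refl (1# ⊕ (1# ⊕ ⊖ a) ⊛ inv a) ⟩
  1# ∎
  where
  open ≈-Reasoning
  open Solver
  1-a : 1# ⊕ ⊖ a ≈[ 1 ] 0#
  1-a = coeffs< λ { zero _ → cong (λ w → 1ℤ ℤ.+ ℤ.- w) a₀ ; (suc _) (s≤s ()) }
  cauchy : ∀ N → approxInv a (suc N) ≈[ N ] approxInv a N
  cauchy zero = coeffs< λ _ ()
  cauchy (suc N) = ⊕-cong[] (≈[]-refl {1#}) (⊛-cong[+] 1 1-a (cauchy N))
  converge : approxInv a ⟶ inv a
  converge = lim-⟶ cauchy
  fixed : inv a ≈ 1# ⊕ (1# ⊕ ⊖ a) ⊛ inv a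
  fixed = ⟶-unique (⟶-subseq suc ℕₚ.n≤1+n converge)
    (⟶-⊕ (⟶-const 1#) (⟶-⊛ (⟶-const (1# ⊕ ⊖ a)) converge))

-- For ε = ±1 the q-Pochhammer symbol (-εqⁱ; qᵈ) with N factors.
P : ℤ → ℕ → ℕ → ℕ → Series
P ε i d zero    = 1#
P ε i d (suc N) = P ε i d N ⊛ (1# ⊕ mono ε (i ℕ.+ N ℕ.* d))

P∞ : ℤ → ℕ → ℕ → Series
P∞ ε i d = lim (P ε i d)

≈[]0⇒⊛≈[] : ∀ {a x k} → x ≈[ k ] 0# → a ⊛ (1# ⊕ x) ≈[ k ] a
≈[]0⇒⊛≈[] {a} {x} {k} p = ≈[]-trans
  (⊛-cong[] {a} ≈[]-refl (⊕-cong[] {1#} ≈[]-refl p))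
  (≈⇒≈[] k (R.trans (⊛-congʳ a (R.+-identityʳ 1#)) (R.*-identityʳ a)))

P-⟶ : ∀ ε i d .{{_ : NonZero d}} → P ε i d ⟶ P∞ ε i d
P-⟶ ε i d = lim-⟶ λ N → ≈[]0⇒⊛≈[] (mono-small ε (ℕₚ.m≤n⇒m≤o+n i (ℕₚ.m≤m*n N d)))

P-head : ∀ ε i d N → 1 ≤ i → P ε i d N 0 ≡ 1ℤ
P-head ε i d zero 1≤i = refl
P-head ε i d (suc N) 1≤i = trans
  (at< (≈[]0⇒⊛≈[] {P ε i d N} (mono-small ε (ℕₚ.m≤n⇒m≤n+o (N ℕ.* d) 1≤i))) 0 (s≤s z≤n))
  (P-head ε i d N 1≤i)

P∞-head : ∀ ε i d → 1 ≤ i → P∞ ε i d 0 ≡ 1ℤ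
P∞-head ε i d = P-head ε i d 1

mono-neg : ∀ x e → mono (ℤ.- x) e ≈ ⊖ mono x e
mono-neg x e = coeffs (go e)
  where
  go : ∀ e n → mono (ℤ.- x) e n ≡ ℤ.- mono x e n
  go zero zero = refl
  go zero (suc n) = refl
  go (suc e) zero = refl
  go (suc e) (suc n) = go e n

-- Sums over antidiagonals and the q-binomial recursion

antidiag : ℕ → (ℕ → ℕ → Series) → Series
antidiag zero    f = f 0 0
antidiag (suc L) f = f 0 (suc L) ⊕ antidiag L (λ j m → f (suc j) m)

antidiag-last : ∀ L f → antidiag (suc L) f ≈ antidiag L (λ j m → f j (suc m)) ⊕ f (suc L) 0
antidiag-last zero f = R.refl
antidiag-last (suc L) f = R.trans
  (⊕-congʳ (f 0 (suc (suc L))) (antidiag-last L (λ j m → f (suc j) m)))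
  (R.sym (R.+-assoc (f 0 (suc (suc L))) (antidiag L (λ j m → f (suc j) (suc m))) (f (suc (suc L)) 0)))

antidiag-cong : ∀ L {f g} → (∀ j m → j ℕ.+ m ≡ L → f j m ≈ g j m) → antidiag L f ≈ antidiag L g
antidiag-cong zero p = p 0 0 refl
antidiag-cong (suc L) p = R.+-cong (p 0 (suc L) refl) (antidiag-cong L λ j m e → p (suc j) m (cong suc e))

antidiag-cong[] : ∀ {M} L {f g} → (∀ j m → j ℕ.+ m ≡ L → f j m ≈[ M ] g j m) → antidiag L f ≈[ M ] antidiag L g
antidiag-cong[] zero p = p 0 0 refl
antidiag-cong[] (suc L) p = ⊕-cong[] (p 0 (suc L) refl) (antidiag-cong[] L λ j m e → p (suc j) m (cong suc e))

antidiag-⊕ : ∀ L f g → antidiag L (λ j m → f j m ⊕ g j m) ≈ antidiag L f ⊕ antidiag L g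
antidiag-⊕ zero f g = R.refl
antidiag-⊕ (suc L) f g = R.trans
  (⊕-congʳ (f 0 (suc L) ⊕ g 0 (suc L)) (antidiag-⊕ L (λ j m → f (suc j) m) (λ j m → g (suc j) m)))
  (solve 4 (λ a b c d → a :+ b :+ (c :+ d) := a :+ c :+ (b :+ d)) R.refl
    (f 0 (suc L)) (g 0 (suc L)) (antidiag L (λ j m → f (suc j) m)) (antidiag L (λ j m → g (suc j) m)))
  where open Solver

antidiag-⊛ : ∀ L x f → x ⊛ antidiag L f ≈ antidiag L (λ j m → x ⊛ f j m)
antidiag-⊛ zero x f = R.refl
antidiag-⊛ (suc L) x f = R.trans
  (R.distribˡ x (f 0 (suc L)) (antidiag L (λ j m → f (suc j) m)))
  (⊕-congʳ (x ⊛ f 0 (suc L)) (antidiag-⊛ L x (λ j m → f (suc j) m)))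

antidiag-zeroˡ : ∀ L f → (∀ m → f 0 m ≈ 0#) → antidiag (suc L) f ≈ antidiag L (λ j m → f (suc j) m)
antidiag-zeroˡ L f p = R.trans (⊕-congˡ (antidiag L (λ j m → f (suc j) m)) (p (suc L)))
  (R.+-identityˡ (antidiag L (λ j m → f (suc j) m)))

antidiag-zeroʳ : ∀ L f → (∀ j → f j 0 ≈ 0#) → antidiag (suc L) f ≈ antidiag L (λ j m → f j (suc m))
antidiag-zeroʳ L f p = R.trans (antidiag-last L f)
  (R.trans (⊕-congʳ (antidiag L (λ j m → f j (suc m))) (p (suc L)))
    (R.+-identityʳ (antidiag L (λ j m → f j (suc m)))))

module Cauchy (d : ℕ) .{{_ : NonZero d}} where

  c^ : ℕ → Series
  c^ n = mono 1ℤ (n ℕ.* d)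

  c^-+ : ∀ m n → c^ (m ℕ.+ n) ≈ c^ m ⊛ c^ n
  c^-+ m n = R.trans (≡⇒≈ (cong (mono 1ℤ) (ℕₚ.*-distribʳ-+ d m n))) (R.sym (mono-⊛ 1ℤ (m ℕ.* d) 1ℤ (n ℕ.* d)))

  poch : ℕ → Series
  poch = P -1ℤ d d

  poch∞ : Series
  poch∞ = P∞ -1ℤ d d

  1≤d : 1 ≤ d
  1≤d = ℕ.>-nonZero⁻¹ d

  poch-suc : ∀ n → poch (suc n) ≈ poch n ⊛ (1# ⊕ ⊖ c^ (suc n))
  poch-suc n = ⊛-congʳ (poch n) (⊕-congʳ 1# (mono-neg 1ℤ (suc n ℕ.* d)))

  ι : ℕ → Series
  ι n = inv (poch n)

  poch-ι : ∀ n → poch n ⊛ ι n ≈ 1#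
  poch-ι n = ⊛-inverseʳ (P-head -1ℤ d d n 1≤d)

  ι-suc : ∀ n → (1# ⊕ ⊖ c^ (suc n)) ⊛ ι (suc n) ≈ ι n
  ι-suc n = ⊛-cancel (P-head -1ℤ d d n 1≤d) (begin
    poch n ⊛ ((1# ⊕ ⊖ c^ (suc n)) ⊛ ι (suc n)) ≈⟨ R.*-assoc (poch n) (1# ⊕ ⊖ c^ (suc n)) (ι (suc n)) ⟨
    poch n ⊛ (1# ⊕ ⊖ c^ (suc n)) ⊛ ι (suc n)   ≈⟨ ⊛-congˡ (ι (suc n)) (poch-suc n) ⟨
    poch (suc n) ⊛ ι (suc n)                   ≈⟨ poch-ι (suc n) ⟩
    1#                                         ≈⟨ poch-ι n ⟨
    poch n ⊛ ι n                               ∎)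
    where open ≈-Reasoning

  -- ∑_{j+m=L} t_j / ((c;c)_j (c;c)_m)
  B : ℕ → (ℕ → Series) → Series
  B L t = antidiag L (λ j m → t j ⊛ (ι j ⊛ ι m))

  private
    -- The factor 1 - cʲ kills the term j = 0 and elsewhere cancels the last factor of (c;c)ⱼ, which
    -- shortens the antidiagonal by one.
    drop-j : ∀ L (t : ℕ → Series) (w : ℕ → Series) →
      antidiag (suc L) (λ j m → (1# ⊕ ⊖ c^ j) ⊛ (w m ⊛ (t j ⊛ (ι j ⊛ ι m)))) ≈
      antidiag L (λ j m → w m ⊛ t (suc j) ⊛ (ι j ⊛ ι m))
    drop-j L t w = R.trans
      (antidiag-zeroˡ L (λ j m → (1# ⊕ ⊖ c^ j) ⊛ (w m ⊛ (t j ⊛ (ι j ⊛ ι m)))) λ m →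
        solve 1 (λ x → (con 1ℤ :- con 1ℤ) :* x := con 0ℤ) R.refl (w m ⊛ (t 0 ⊛ (ι 0 ⊛ ι m))))
      (antidiag-cong L λ j m _ → R.trans
        (solve 5 (λ e w t i k → e :* (w :* (t :* (i :* k))) := w :* t :* ((e :* i) :* k)) R.refl
          (1# ⊕ ⊖ c^ (suc j)) (w m) (t (suc j)) (ι (suc j)) (ι m))
        (⊛-congʳ (w m ⊛ t (suc j)) (⊛-congˡ (ι m) (ι-suc j))))
      where open Solver

    drop-m : ∀ L (t : ℕ → Series) (w : ℕ → Series) →
      antidiag (suc L) (λ j m → (1# ⊕ ⊖ c^ m) ⊛ (w j ⊛ (t j ⊛ (ι j ⊛ ι m)))) ≈
      antidiag L (λ j m → w j ⊛ t j ⊛ (ι j ⊛ ι m))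
    drop-m L t w = R.trans
      (antidiag-zeroʳ L (λ j m → (1# ⊕ ⊖ c^ m) ⊛ (w j ⊛ (t j ⊛ (ι j ⊛ ι m)))) λ j →
        solve 1 (λ x → (con 1ℤ :- con 1ℤ) :* x := con 0ℤ) R.refl (w j ⊛ (t j ⊛ (ι j ⊛ ι 0))))
      (antidiag-cong L λ j m _ → R.trans
        (solve 5 (λ e w t i k → e :* (w :* (t :* (i :* k))) := w :* t :* (i :* (e :* k))) R.refl
          (1# ⊕ ⊖ c^ (suc m)) (w j) (t j) (ι j) (ι (suc m)))
        (⊛-congʳ (w j ⊛ t j) (⊛-congʳ (ι j) (ι-suc m))))
      where open Solver

  -- One of the two q-Pascal rules, from the splitting 1 - cʲ⁺ᵐ = (1 - cᵐ) + cᵐ(1 - cʲ). The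
  -- condition on x makes the second part a multiple of the first.
  B-stepᵃ : ∀ L t x → (∀ j m → j ℕ.+ m ≡ L → x ⊛ t j ≈ c^ m ⊛ t (suc j)) →
            (1# ⊕ ⊖ c^ (suc L)) ⊛ B (suc L) t ≈ (1# ⊕ x) ⊛ B L t
  B-stepᵃ L t x p = begin
    (1# ⊕ ⊖ c^ (suc L)) ⊛ B (suc L) t
      ≈⟨ antidiag-⊛ (suc L) (1# ⊕ ⊖ c^ (suc L)) (λ j m → t j ⊛ (ι j ⊛ ι m)) ⟩
    antidiag (suc L) (λ j m → (1# ⊕ ⊖ c^ (suc L)) ⊛ (t j ⊛ (ι j ⊛ ι m)))
      ≈⟨ antidiag-cong (suc L) (λ j m e → R.trans
           (⊛-congˡ (t j ⊛ (ι j ⊛ ι m)) (⊕-congʳ 1# (R.-‿cong (R.trans (≡⇒≈ (cong c^ (sym e))) (c^-+ j m)))))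
           (solve 3 (λ y z w → (con 1ℤ :- y :* z) :* w := (con 1ℤ :- z) :* (con 1ℤ :* w) :+ (con 1ℤ :- y) :* (z :* w))
             R.refl (c^ j) (c^ m) (t j ⊛ (ι j ⊛ ι m)))) ⟩
    antidiag (suc L) (λ j m → (1# ⊕ ⊖ c^ m) ⊛ (1# ⊛ (t j ⊛ (ι j ⊛ ι m))) ⊕ (1# ⊕ ⊖ c^ j) ⊛ (c^ m ⊛ (t j ⊛ (ι j ⊛ ι m))))
      ≈⟨ antidiag-⊕ (suc L) (λ j m → (1# ⊕ ⊖ c^ m) ⊛ (1# ⊛ (t j ⊛ (ι j ⊛ ι m))))
           (λ j m → (1# ⊕ ⊖ c^ j) ⊛ (c^ m ⊛ (t j ⊛ (ι j ⊛ ι m)))) ⟩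
    antidiag (suc L) (λ j m → (1# ⊕ ⊖ c^ m) ⊛ (1# ⊛ (t j ⊛ (ι j ⊛ ι m)))) ⊕
    antidiag (suc L) (λ j m → (1# ⊕ ⊖ c^ j) ⊛ (c^ m ⊛ (t j ⊛ (ι j ⊛ ι m))))
      ≈⟨ R.+-cong (drop-m L t (λ _ → 1#)) (drop-j L t c^) ⟩
    antidiag L (λ j m → 1# ⊛ t j ⊛ (ι j ⊛ ι m)) ⊕ antidiag L (λ j m → c^ m ⊛ t (suc j) ⊛ (ι j ⊛ ι m))
      ≈⟨ R.+-cong (antidiag-cong L (λ j m _ → ⊛-congˡ (ι j ⊛ ι m) (R.*-identityˡ (t j))))
           (antidiag-cong L (λ j m e → R.trans (⊛-congˡ (ι j ⊛ ι m) (R.sym (p j m e))) (R.*-assoc x (t j) (ι j ⊛ ι m)))) ⟩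
    B L t ⊕ antidiag L (λ j m → x ⊛ (t j ⊛ (ι j ⊛ ι m)))
      ≈⟨ ⊕-congʳ (B L t) (antidiag-⊛ L x (λ j m → t j ⊛ (ι j ⊛ ι m))) ⟨
    B L t ⊕ x ⊛ B L t
      ≈⟨ solve 2 (λ b x → b :+ x :* b := (con 1ℤ :+ x) :* b) R.refl (B L t) x ⟩
    (1# ⊕ x) ⊛ B L t ∎
    where
    open ≈-Reasoning
    open Solver

  -- The other q-Pascal rule, from 1 - cʲ⁺ᵐ = (1 - cʲ) + cʲ(1 - cᵐ). Here t' is t with a new entry
  -- in front, so the sequence grows to the left.
  B-stepᵇ : ∀ L t t' y → (∀ j → t' (suc j) ≈ t j) → (∀ j → y ⊛ t j ≈ c^ j ⊛ t' j) →
            (1# ⊕ ⊖ c^ (suc L)) ⊛ B (suc L) t' ≈ (1# ⊕ y) ⊛ B L t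
  B-stepᵇ L t t' y sh p = begin
    (1# ⊕ ⊖ c^ (suc L)) ⊛ B (suc L) t'
      ≈⟨ antidiag-⊛ (suc L) (1# ⊕ ⊖ c^ (suc L)) (λ j m → t' j ⊛ (ι j ⊛ ι m)) ⟩
    antidiag (suc L) (λ j m → (1# ⊕ ⊖ c^ (suc L)) ⊛ (t' j ⊛ (ι j ⊛ ι m)))
      ≈⟨ antidiag-cong (suc L) (λ j m e → R.trans
           (⊛-congˡ (t' j ⊛ (ι j ⊛ ι m)) (⊕-congʳ 1# (R.-‿cong (R.trans (≡⇒≈ (cong c^ (sym e))) (c^-+ j m)))))
           (solve 3 (λ y z w → (con 1ℤ :- y :* z) :* w := (con 1ℤ :- y) :* (con 1ℤ :* w) :+ (con 1ℤ :- z) :* (y :* w))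
             R.refl (c^ j) (c^ m) (t' j ⊛ (ι j ⊛ ι m)))) ⟩
    antidiag (suc L) (λ j m → (1# ⊕ ⊖ c^ j) ⊛ (1# ⊛ (t' j ⊛ (ι j ⊛ ι m))) ⊕ (1# ⊕ ⊖ c^ m) ⊛ (c^ j ⊛ (t' j ⊛ (ι j ⊛ ι m))))
      ≈⟨ antidiag-⊕ (suc L) (λ j m → (1# ⊕ ⊖ c^ j) ⊛ (1# ⊛ (t' j ⊛ (ι j ⊛ ι m))))
           (λ j m → (1# ⊕ ⊖ c^ m) ⊛ (c^ j ⊛ (t' j ⊛ (ι j ⊛ ι m)))) ⟩
    antidiag (suc L) (λ j m → (1# ⊕ ⊖ c^ j) ⊛ (1# ⊛ (t' j ⊛ (ι j ⊛ ι m)))) ⊕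
    antidiag (suc L) (λ j m → (1# ⊕ ⊖ c^ m) ⊛ (c^ j ⊛ (t' j ⊛ (ι j ⊛ ι m))))
      ≈⟨ R.+-cong (drop-j L t' (λ _ → 1#)) (drop-m L t' c^) ⟩
    antidiag L (λ j m → 1# ⊛ t' (suc j) ⊛ (ι j ⊛ ι m)) ⊕ antidiag L (λ j m → c^ j ⊛ t' j ⊛ (ι j ⊛ ι m))
      ≈⟨ R.+-cong (antidiag-cong L (λ j m _ → ⊛-congˡ (ι j ⊛ ι m) (R.trans (R.*-identityˡ (t' (suc j))) (sh j))))
           (antidiag-cong L (λ j m _ → R.trans (⊛-congˡ (ι j ⊛ ι m) (R.sym (p j))) (R.*-assoc y (t j) (ι j ⊛ ι m)))) ⟩
    B L t ⊕ antidiag L (λ j m → y ⊛ (t j ⊛ (ι j ⊛ ι m)))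
      ≈⟨ ⊕-congʳ (B L t) (antidiag-⊛ L y (λ j m → t j ⊛ (ι j ⊛ ι m))) ⟨
    B L t ⊕ y ⊛ B L t
      ≈⟨ solve 2 (λ b x → b :+ x :* b := (con 1ℤ :+ x) :* b) R.refl (B L t) y ⟩
    (1# ⊕ y) ⊛ B L t ∎
    where
    open ≈-Reasoning
    open Solver

-- This is εᵏ q^(ik + dk(k-1)/2). For d = i + j and ε² = 1 it is Ramanujan's a^(k(k+1)/2)
-- b^(k(k-1)/2) with a = εqⁱ and b = εqʲ.
term : ℤ → ℕ → ℕ → ℕ → Series
term ε i d zero    = 1#
term ε i d (suc k) = term ε i d k ⊛ mono ε (i ℕ.+ k ℕ.* d)

term-small : ∀ ε i d k → 1 ≤ i → term ε i d k ≈[ k ] 0#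
term-small ε i d zero 1≤i = coeffs< λ _ ()
term-small ε i d (suc k) 1≤i = ≈[]-trans
  (≈[]-mono (ℕₚ.≤-reflexive (ℕₚ.+-comm 1 k))
    (⊛-cong[+] k (term-small ε i d k 1≤i) (mono-small ε (ℕₚ.m≤n⇒m≤n+o (k ℕ.* d) 1≤i))))
  (≈⇒≈[] (suc k) (R.zeroʳ (term ε i d k)))

-- partial sums of Ramanujan's f(εqⁱ, εqʲ)
θ : ℤ → ℕ → ℕ → ℕ → Series
θ ε i j N = sum (suc N) (term ε i (i ℕ.+ j)) ⊕ sum N (λ k → term ε j (i ℕ.+ j) (suc k))

module JacobiTripleProduct (ε : ℤ) (ε² : ε ℤ.* ε ≡ 1ℤ) (i j : ℕ) (1≤i : 1 ≤ i) (1≤j : 1 ≤ j) where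

  d : ℕ
  d = i ℕ.+ j

  instance
    d≢0 : NonZero d
    d≢0 = ℕ.>-nonZero (ℕₚ.m≤n⇒m≤n+o j 1≤i)

  open Cauchy d

  -- row N lists the two-sided sequence of theta terms, starting N places to the left of its centre.
  row : ℕ → ℕ → Series
  row zero    k       = term ε i d k
  row (suc N) zero    = term ε j d (suc N)
  row (suc N) (suc k) = row N k

  row-head : ∀ N → row N 0 ≈ term ε j d N
  row-head zero = R.refl
  row-head (suc N) = R.refl

  -- Entry k of row N + 1 is the left neighbour of entry k of row N in the theta series. The ratio
  -- of neighbours is multiplied by c = qᵈ with each place to the right, as `B-stepᵇ` requires.
  row-ratio : ∀ N k → mono ε (j ℕ.+ N ℕ.* d) ⊛ row N k ≈ c^ k ⊛ row (suc N) k
  row-ratio N zero = begin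
    mono ε (j ℕ.+ N ℕ.* d) ⊛ row N 0
      ≈⟨ ⊛-congʳ (mono ε (j ℕ.+ N ℕ.* d)) (row-head N) ⟩
    mono ε (j ℕ.+ N ℕ.* d) ⊛ term ε j d N
      ≈⟨ solve 2 (λ x y → x :* y := con 1ℤ :* (y :* x)) R.refl (mono ε (j ℕ.+ N ℕ.* d)) (term ε j d N) ⟩
    c^ 0 ⊛ term ε j d (suc N) ∎
    where
    open ≈-Reasoning
    open Solver
  -- The two halves meet at the centre: the signs cancel by ε² = 1 and the exponents i and j add up
  -- to d.
  row-ratio zero (suc k) = begin
    mono ε (j ℕ.+ 0) ⊛ (term ε i d k ⊛ mono ε (i ℕ.+ k ℕ.* d))
      ≈⟨ solve 3 (λ x y z → x :* (y :* z) := x :* z :* y) R.refl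
           (mono ε (j ℕ.+ 0)) (term ε i d k) (mono ε (i ℕ.+ k ℕ.* d)) ⟩
    mono ε (j ℕ.+ 0) ⊛ mono ε (i ℕ.+ k ℕ.* d) ⊛ term ε i d k
      ≈⟨ ⊛-congˡ (term ε i d k) (R.trans (mono-⊛ ε (j ℕ.+ 0) ε (i ℕ.+ k ℕ.* d)) (≡⇒≈ (cong₂ mono ε²
           (ℕS.solve 3 (λ i j e → (j ℕS.:+ ℕS.con 0) ℕS.:+ (i ℕS.:+ e) ℕS.:= (i ℕS.:+ j) ℕS.:+ e) refl i j (k ℕ.* d))))) ⟩
    c^ (suc k) ⊛ term ε i d k ∎
    where
    open ≈-Reasoning
    open Solver
    module ℕS = ℕSolver
  row-ratio (suc N) (suc k) = begin
    mono ε (j ℕ.+ suc N ℕ.* d) ⊛ row N k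
      ≈⟨ ⊛-congˡ (row N k) (R.trans
           (≡⇒≈ (cong₂ mono (sym (ℤₚ.*-identityˡ ε))
             (ℕS.solve 3 (λ d j e → j ℕS.:+ (d ℕS.:+ e) ℕS.:= d ℕS.:+ (j ℕS.:+ e)) refl d j (N ℕ.* d))))
           (R.sym (mono-⊛ 1ℤ d ε (j ℕ.+ N ℕ.* d)))) ⟩
    mono 1ℤ d ⊛ mono ε (j ℕ.+ N ℕ.* d) ⊛ row N k
      ≈⟨ R.*-assoc (mono 1ℤ d) (mono ε (j ℕ.+ N ℕ.* d)) (row N k) ⟩
    mono 1ℤ d ⊛ (mono ε (j ℕ.+ N ℕ.* d) ⊛ row N k)
      ≈⟨ ⊛-congʳ (mono 1ℤ d) (row-ratio N k) ⟩
    mono 1ℤ d ⊛ (c^ k ⊛ row (suc N) k)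
      ≈⟨ R.*-assoc (mono 1ℤ d) (c^ k) (row (suc N) k) ⟨
    mono 1ℤ d ⊛ c^ k ⊛ row (suc N) k
      ≈⟨ ⊛-congˡ (row (suc N) k) (mono-⊛ 1ℤ d 1ℤ (k ℕ.* d)) ⟩
    c^ (suc k) ⊛ row (suc N) k ∎
    where
    open ≈-Reasoning
    module ℕS = ℕSolver

  private
    poch-suc-B : ∀ L t → poch (suc L) ⊛ B (suc L) t ≈ poch L ⊛ ((1# ⊕ ⊖ c^ (suc L)) ⊛ B (suc L) t)
    poch-suc-B L t = R.trans (⊛-congˡ (B (suc L) t) (poch-suc L)) (R.*-assoc (poch L) (1# ⊕ ⊖ c^ (suc L)) (B (suc L) t))

  -- The finite q-binomial theorem: `poch M ⊛ ι j ⊛ ι m` with j + m = M is a Gaussian binomial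
  -- coefficient.
  finite₀ : ∀ M → poch M ⊛ B M (row 0) ≈ P ε i d M
  finite₀ zero = R.trans (solve 1 (λ x → con 1ℤ :* (con 1ℤ :* (x :* x)) := (con 1ℤ :* x) :* (con 1ℤ :* x)) R.refl (ι 0))
    (R.trans (R.*-cong (poch-ι 0) (poch-ι 0)) (R.*-identityˡ 1#))
    where open Solver
  finite₀ (suc M) = begin
    poch (suc M) ⊛ B (suc M) (row 0)
      ≈⟨ poch-suc-B M (row 0) ⟩
    poch M ⊛ ((1# ⊕ ⊖ c^ (suc M)) ⊛ B (suc M) (row 0))
      ≈⟨ ⊛-congʳ (poch M) (B-stepᵃ M (row 0) x ratio) ⟩
    poch M ⊛ ((1# ⊕ x) ⊛ B M (row 0))
      ≈⟨ solve 3 (λ p y b → p :* (y :* b) := p :* b :* y) R.refl (poch M) (1# ⊕ x) (B M (row 0)) ⟩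
    poch M ⊛ B M (row 0) ⊛ (1# ⊕ x)
      ≈⟨ ⊛-congˡ (1# ⊕ x) (finite₀ M) ⟩
    P ε i d (suc M) ∎
    where
    open ≈-Reasoning
    open Solver
    module ℕS = ℕSolver
    x : Series
    x = mono ε (i ℕ.+ M ℕ.* d)
    ratio : ∀ k m → k ℕ.+ m ≡ M → x ⊛ term ε i d k ≈ c^ m ⊛ term ε i d (suc k)
    ratio k m e = begin
      x ⊛ term ε i d k
        ≈⟨ ⊛-congˡ (term ε i d k) (R.trans
             (≡⇒≈ (cong₂ mono (sym (ℤₚ.*-identityˡ ε)) (trans (cong (λ w → i ℕ.+ w ℕ.* d) (sym e))
               (ℕS.solve 4 (λ i k m d → i ℕS.:+ (k ℕS.:+ m) ℕS.:* d ℕS.:= m ℕS.:* d ℕS.:+ (i ℕS.:+ k ℕS.:* d)) refl i k m d))))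
             (R.sym (mono-⊛ 1ℤ (m ℕ.* d) ε (i ℕ.+ k ℕ.* d)))) ⟩
      c^ m ⊛ mono ε (i ℕ.+ k ℕ.* d) ⊛ term ε i d k
        ≈⟨ solve 3 (λ x y z → x :* y :* z := x :* (z :* y)) R.refl (c^ m) (mono ε (i ℕ.+ k ℕ.* d)) (term ε i d k) ⟩
      c^ m ⊛ term ε i d (suc k) ∎

  -- Cauchy's finite form of the triple product. Each factor with base exponent j shifts the centre
  -- of the theta sequence one place.
  finite : ∀ M N → poch (N ℕ.+ M) ⊛ B (N ℕ.+ M) (row N) ≈ P ε i d M ⊛ P ε j d N
  finite M zero = R.trans (finite₀ M) (R.sym (R.*-identityʳ (P ε i d M)))
  finite M (suc N) = begin
    poch (suc N ℕ.+ M) ⊛ B (suc N ℕ.+ M) (row (suc N))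
      ≈⟨ poch-suc-B (N ℕ.+ M) (row (suc N)) ⟩
    poch (N ℕ.+ M) ⊛ ((1# ⊕ ⊖ c^ (suc (N ℕ.+ M))) ⊛ B (suc (N ℕ.+ M)) (row (suc N)))
      ≈⟨ ⊛-congʳ (poch (N ℕ.+ M)) (B-stepᵇ (N ℕ.+ M) (row N) (row (suc N)) y (λ _ → R.refl) (row-ratio N)) ⟩
    poch (N ℕ.+ M) ⊛ ((1# ⊕ y) ⊛ B (N ℕ.+ M) (row N))
      ≈⟨ solve 3 (λ p y b → p :* (y :* b) := p :* b :* y) R.refl (poch (N ℕ.+ M)) (1# ⊕ y) (B (N ℕ.+ M) (row N)) ⟩
    poch (N ℕ.+ M) ⊛ B (N ℕ.+ M) (row N) ⊛ (1# ⊕ y)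
      ≈⟨ ⊛-congˡ (1# ⊕ y) (finite M N) ⟩
    P ε i d M ⊛ P ε j d N ⊛ (1# ⊕ y)
      ≈⟨ R.*-assoc (P ε i d M) (P ε j d N) (1# ⊕ y) ⟩
    P ε i d M ⊛ P ε j d (suc N) ∎
    where
    open ≈-Reasoning
    open Solver
    y : Series
    y = mono ε (j ℕ.+ N ℕ.* d)

  row-smallˡ : ∀ N k → row N k ≈[ N ℕ.∸ k ] 0#
  row-smallˡ zero k = ≈[]-mono (ℕₚ.≤-reflexive (ℕₚ.0∸n≡0 k)) (coeffs< λ _ ())
  row-smallˡ (suc N) zero = term-small ε j d (suc N) 1≤j
  row-smallˡ (suc N) (suc k) = row-smallˡ N k

  row-smallʳ : ∀ N k → row N k ≈[ k ℕ.∸ N ] 0#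
  row-smallʳ zero k = term-small ε i d k 1≤i
  row-smallʳ (suc N) zero = coeffs< λ _ ()
  row-smallʳ (suc N) (suc k) = row-smallʳ N k

  poch∞-ι : ∀ n → poch∞ ⊛ ι n ≈[ n ] 1#
  poch∞-ι n = ≈[]-trans (⊛-cong[] (≈[]-sym (mod-q^ (P-⟶ -1ℤ d d) n n ℕₚ.≤-refl)) (≈[]-refl {ι n})) (≈⇒≈[] n (poch-ι n))

  -- The two correction factors are 1 only modulo qᵏ and qᵐ, which is weak near the ends of the
  -- antidiagonal. There the theta term compensates: it is divisible by q to the distance of k from
  -- the centre N, and N ≤ (k - N) + m as well as N ≤ (N - k) + k.
  summand : ∀ N k m → k ℕ.+ m ≡ N ℕ.+ N → row N k ⊛ ((poch∞ ⊛ ι k) ⊛ (poch∞ ⊛ ι m)) ≈[ N ] row N k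
  summand N k m e = ≈[]-trans (≈[]-trans
    (≈⇒≈[] N (R.sym (R.*-assoc (row N k) (poch∞ ⊛ ι k) (poch∞ ⊛ ι m))))
    (≈[]-trans
      (≈[]-mono near
        (⊛-cong[+] (k ℕ.∸ N) (near-small (poch∞ ⊛ ι k) (row-smallʳ N k)) (poch∞-ι m)))
      (≈⇒≈[] N (R.*-identityʳ (row N k ⊛ (poch∞ ⊛ ι k))))))
    (≈[]-trans
      (≈[]-mono (ℕₚ.≤-trans (ℕₚ.m≤n+m∸n N k) (ℕₚ.≤-reflexive (ℕₚ.+-comm k (N ℕ.∸ k))))
        (⊛-cong[+] (N ℕ.∸ k) (row-smallˡ N k) (poch∞-ι k)))
      (≈⇒≈[] N (R.*-identityʳ (row N k))))
    where
    near-small : ∀ {K} x → row N k ≈[ K ] 0# → row N k ⊛ x ≈[ K ] 0#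
    near-small {K} x p = ≈[]-trans (⊛-cong[] p (≈[]-refl {x})) (≈⇒≈[] K (R.zeroˡ x))
    near : N ≤ (k ℕ.∸ N) ℕ.+ m
    near = ℕₚ.+-cancelʳ-≤ N N ((k ℕ.∸ N) ℕ.+ m) (ℕₚ.≤-trans (ℕₚ.≤-reflexive (sym e))
      (ℕₚ.≤-trans (ℕₚ.+-monoˡ-≤ m (ℕₚ.m≤n+m∸n k N)) (ℕₚ.≤-reflexive
        (ℕSolver.solve 3 (λ n x m → (n ℕSolver.:+ x) ℕSolver.:+ m ℕSolver.:= (x ℕSolver.:+ m) ℕSolver.:+ n) refl N (k ℕ.∸ N) m))))

  antidiag-row : ∀ M N → antidiag (N ℕ.+ M) (λ k _ → row N k) ≈ sum (suc M) (term ε i d) ⊕ sum N (λ k → term ε j d (suc k))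
  antidiag-row zero zero = solve 1 (λ x → x := con 0ℤ :+ x :+ con 0ℤ) R.refl 1#
    where open Solver
  antidiag-row (suc M) zero = R.trans (antidiag-last M (λ k _ → row 0 k)) (R.trans
    (⊕-congˡ (term ε i d (suc M)) (antidiag-row M zero))
    (solve 2 (λ s x → s :+ con 0ℤ :+ x := s :+ x :+ con 0ℤ) R.refl (sum (suc M) (term ε i d)) (term ε i d (suc M))))
    where open Solver
  antidiag-row M (suc N) = R.trans
    (⊕-congʳ (term ε j d (suc N)) (antidiag-row M N))
    (solve 3 (λ x s t → x :+ (s :+ t) := s :+ (t :+ x)) R.refl
      (term ε j d (suc N)) (sum (suc M) (term ε i d)) (sum N (λ k → term ε j d (suc k))))
    where open Solver

  theorem : θ ε i j ⟶ poch∞ ⊛ P∞ ε i d ⊛ P∞ ε j d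
  theorem = converges λ M N M≤N → ≈[]-mono M≤N (≈[]-sym (main N))
    where
    open Solver
    main : ∀ N → poch∞ ⊛ P∞ ε i d ⊛ P∞ ε j d ≈[ N ] θ ε i j N
    main N =
      ≈[]-trans (⊛-cong[] (⊛-cong[] (≈[]-refl {poch∞}) (≈[]-sym (mod-q^ (P-⟶ ε i d) N N ℕₚ.≤-refl)))
                          (≈[]-sym (mod-q^ (P-⟶ ε j d) N N ℕₚ.≤-refl)))
      (≈[]-trans (≈⇒≈[] N (R.trans (R.*-assoc poch∞ (P ε i d N) (P ε j d N)) (⊛-congʳ poch∞ (R.sym (finite N N)))))
      -- Replacing `poch (N + N)` by its limit gives a second factor `poch∞`, so that `ι k` and
      -- `ι m` receive one each.
      (≈[]-trans (⊛-cong[] (≈[]-refl {poch∞}) (⊛-cong[]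
          (mod-q^ (P-⟶ -1ℤ d d) N (N ℕ.+ N) (ℕₚ.m≤m+n N N)) (≈[]-refl {B (N ℕ.+ N) (row N)})))
      (≈[]-trans (≈⇒≈[] N (R.trans (R.sym (R.*-assoc poch∞ poch∞ (B (N ℕ.+ N) (row N))))
          (antidiag-⊛ (N ℕ.+ N) (poch∞ ⊛ poch∞) (λ k m → row N k ⊛ (ι k ⊛ ι m)))))
      (≈[]-trans (antidiag-cong[] (N ℕ.+ N) (λ k m e → ≈[]-trans
          (≈⇒≈[] N (solve 4 (λ p t x y → p :* p :* (t :* (x :* y)) := t :* ((p :* x) :* (p :* y))) R.refl
            poch∞ (row N k) (ι k) (ι m)))
          (summand N k m e)))
      (≈⇒≈[] N (antidiag-row N N))))))

-- Eta products and theta functions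

mono-≡ : ∀ {x y e f} → x ≡ y → e ≡ f → mono x e ≈ mono y f
mono-≡ p r = ≡⇒≈ (cong₂ mono p r)

P-2 : ∀ ε i d N → P ε i d (N ℕ.* 2) ≈ P ε i (d ℕ.* 2) N ⊛ P ε (i ℕ.+ d) (d ℕ.* 2) N
P-2 ε i d zero = R.sym (R.*-identityʳ 1#)
P-2 ε i d (suc N) = R.trans
  (R.*-cong (R.*-cong (P-2 ε i d N)
    (⊕-congʳ 1# (mono-≡ {ε} refl (solve 3 (λ i d N → i :+ N :* con 2 :* d := i :+ N :* (d :* con 2)) refl i d N))))
    (⊕-congʳ 1# (mono-≡ {ε} refl (solve 3 (λ i d N → i :+ (d :+ N :* con 2 :* d) := i :+ d :+ N :* (d :* con 2)) refl i d N))))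
  (S.solve 4 (λ p r x y → p S.:* r S.:* x S.:* y S.:= p S.:* x S.:* (r S.:* y)) R.refl
    (P ε i (d ℕ.* 2) N) (P ε (i ℕ.+ d) (d ℕ.* 2) N)
    (1# ⊕ mono ε (i ℕ.+ N ℕ.* (d ℕ.* 2))) (1# ⊕ mono ε (i ℕ.+ d ℕ.+ N ℕ.* (d ℕ.* 2))))
  where
  open ℕSolver
  module S = Solver

P-3 : ∀ ε i d N → P ε i d (N ℕ.* 3) ≈
  P ε i (d ℕ.* 3) N ⊛ P ε (i ℕ.+ d) (d ℕ.* 3) N ⊛ P ε (i ℕ.+ d ℕ.+ d) (d ℕ.* 3) N
P-3 ε i d zero = S.solve 0 (S.con 1ℤ S.:= S.con 1ℤ S.:* S.con 1ℤ S.:* S.con 1ℤ) R.refl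
  where module S = Solver
P-3 ε i d (suc N) = R.trans
  (R.*-cong (R.*-cong (R.*-cong (P-3 ε i d N)
    (⊕-congʳ 1# (mono-≡ {ε} refl (solve 3 (λ i d N → i :+ N :* con 3 :* d := i :+ N :* (d :* con 3)) refl i d N))))
    (⊕-congʳ 1# (mono-≡ {ε} refl (solve 3 (λ i d N → i :+ (d :+ N :* con 3 :* d) := i :+ d :+ N :* (d :* con 3)) refl i d N))))
    (⊕-congʳ 1# (mono-≡ {ε} refl (solve 3 (λ i d N → i :+ (d :+ (d :+ N :* con 3 :* d)) := i :+ d :+ d :+ N :* (d :* con 3)) refl i d N))))
  (S.solve 6 (λ p r s x y z → p S.:* r S.:* s S.:* x S.:* y S.:* z S.:= p S.:* x S.:* (r S.:* y) S.:* (s S.:* z)) R.refl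
    (P ε i (d ℕ.* 3) N) (P ε (i ℕ.+ d) (d ℕ.* 3) N) (P ε (i ℕ.+ d ℕ.+ d) (d ℕ.* 3) N)
    (1# ⊕ mono ε (i ℕ.+ N ℕ.* (d ℕ.* 3))) (1# ⊕ mono ε (i ℕ.+ d ℕ.+ N ℕ.* (d ℕ.* 3)))
    (1# ⊕ mono ε (i ℕ.+ d ℕ.+ d ℕ.+ N ℕ.* (d ℕ.* 3))))
  where
  open ℕSolver
  module S = Solver

P-± : ∀ i d N → P 1ℤ i d N ⊛ P -1ℤ i d N ≈ P -1ℤ (i ℕ.* 2) (d ℕ.* 2) N
P-± i d zero = R.*-identityʳ 1#
P-± i d (suc N) = R.trans
  (⊛-congʳ (P 1ℤ i d (suc N)) (⊛-congʳ (P -1ℤ i d N) (⊕-congʳ 1# (mono-neg 1ℤ (i ℕ.+ N ℕ.* d)))))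
  (R.trans
    (S.solve 3 (λ p r x → p S.:* (S.con 1ℤ S.:+ x) S.:* (r S.:* (S.con 1ℤ S.:- x)) S.:= p S.:* r S.:* (S.con 1ℤ S.:- x S.:* x)) R.refl
      (P 1ℤ i d N) (P -1ℤ i d N) (mono 1ℤ (i ℕ.+ N ℕ.* d)))
    (R.*-cong (P-± i d N) (⊕-congʳ 1# (R.trans
      (R.-‿cong (R.trans (mono-⊛ 1ℤ (i ℕ.+ N ℕ.* d) 1ℤ (i ℕ.+ N ℕ.* d)) (mono-≡ {1ℤ} refl
        (solve 3 (λ i d N → i :+ N :* d :+ (i :+ N :* d) := i :* con 2 :+ N :* (d :* con 2)) refl i d N))))
      (R.sym (mono-neg 1ℤ (i ℕ.* 2 ℕ.+ N ℕ.* (d ℕ.* 2))))))))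
  where
  open ℕSolver
  module S = Solver

V-P : ∀ ε i d N → V (P ε i d N) ≈ P ε (i ℕ.* 3) (d ℕ.* 3) N
V-P ε i d zero = V-const 1ℤ
V-P ε i d (suc N) = R.trans (V-⊛ (P ε i d N) (1# ⊕ mono ε (i ℕ.+ N ℕ.* d)))
  (R.*-cong (V-P ε i d N) (R.trans (V-⊕ 1# (mono ε (i ℕ.+ N ℕ.* d))) (R.+-cong (V-const 1ℤ)
    (R.trans (V-mono ε (i ℕ.+ N ℕ.* d))
      (mono-≡ {ε} refl (solve 3 (λ i d N → (i :+ N :* d) :* con 3 := i :* con 3 :+ N :* (d :* con 3)) refl i d N))))))
  where open ℕSolver

module _ (i d : ℕ) .{{_ : NonZero d}} where
  private instance
    d2≢0 : NonZero (d ℕ.* 2)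
    d2≢0 = ℕₚ.m*n≢0 d 2
    d3≢0 : NonZero (d ℕ.* 3)
    d3≢0 = ℕₚ.m*n≢0 d 3

  P∞-2 : ∀ ε → P∞ ε i d ≈ P∞ ε i (d ℕ.* 2) ⊛ P∞ ε (i ℕ.+ d) (d ℕ.* 2)
  P∞-2 ε = ⟶-unique (⟶-subseq (ℕ._* 2) (λ N → ℕₚ.m≤m*n N 2) (P-⟶ ε i d))
    (⟶-cong (P-2 ε i d) (⟶-⊛ (P-⟶ ε i (d ℕ.* 2)) (P-⟶ ε (i ℕ.+ d) (d ℕ.* 2))))

  P∞-3 : ∀ ε → P∞ ε i d ≈ P∞ ε i (d ℕ.* 3) ⊛ P∞ ε (i ℕ.+ d) (d ℕ.* 3) ⊛ P∞ ε (i ℕ.+ d ℕ.+ d) (d ℕ.* 3)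
  P∞-3 ε = ⟶-unique (⟶-subseq (ℕ._* 3) (λ N → ℕₚ.m≤m*n N 3) (P-⟶ ε i d))
    (⟶-cong (P-3 ε i d) (⟶-⊛ (⟶-⊛ (P-⟶ ε i (d ℕ.* 3)) (P-⟶ ε (i ℕ.+ d) (d ℕ.* 3))) (P-⟶ ε (i ℕ.+ d ℕ.+ d) (d ℕ.* 3))))

  P∞-± : P∞ 1ℤ i d ⊛ P∞ -1ℤ i d ≈ P∞ -1ℤ (i ℕ.* 2) (d ℕ.* 2)
  P∞-± = ⟶-unique (⟶-⊛ (P-⟶ 1ℤ i d) (P-⟶ -1ℤ i d)) (⟶-cong (P-± i d) (P-⟶ -1ℤ (i ℕ.* 2) (d ℕ.* 2)))

  V-P∞ : ∀ ε → V (P∞ ε i d) ≈ P∞ ε (i ℕ.* 3) (d ℕ.* 3)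
  V-P∞ ε = ⟶-unique (⟶-V (P-⟶ ε i d)) (⟶-cong (V-P ε i d) (P-⟶ ε (i ℕ.* 3) (d ℕ.* 3)))

η : ℕ → Series
η m = P∞ -1ℤ m m

-- In Ramanujan's notation φ, ψ, Ω, A are φ(-q), ψ(q), f(-q,-q⁵), f(q,q²).
f₁ f₂ f₃ f₆ h g φ ψ Ω A : Series
f₁ = η 1
f₂ = η 2
f₃ = η 3
f₆ = η 6
h = f₁ ⊛ f₂
g = f₃ ⊛ f₆
φ = η 2 ⊛ P∞ -1ℤ 1 2 ⊛ P∞ -1ℤ 1 2
ψ = η 4 ⊛ P∞ 1ℤ 1 4 ⊛ P∞ 1ℤ 3 4
Ω = η 6 ⊛ P∞ -1ℤ 1 6 ⊛ P∞ -1ℤ 5 6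
A = η 3 ⊛ P∞ 1ℤ 1 3 ⊛ P∞ 1ℤ 2 3

head-⊛ : ∀ {a b} → a 0 ≡ 1ℤ → b 0 ≡ 1ℤ → (a ⊛ b) 0 ≡ 1ℤ
head-⊛ p r = cong₂ ℤ._*_ p r

η-head : ∀ m .{{_ : NonZero m}} → η m 0 ≡ 1ℤ
η-head m = P∞-head -1ℤ m m (ℕ.>-nonZero⁻¹ m)

V-h : V h ≈ g
V-h = R.trans (V-⊛ f₁ f₂) (R.*-cong (V-P∞ 1 1 -1ℤ) (V-P∞ 2 2 -1ℤ))

f₁-2 : f₁ ≈ P∞ -1ℤ 1 2 ⊛ f₂
f₁-2 = P∞-2 1 1 -1ℤ

-- The eta quotients are φ = f₁²/f₂, ψ = f₂²/f₁, A = f₂f₃²/(f₁f₆) and Ω = f₁f₆²/(f₂f₃). The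
-- denominators cancel in φψ and in ΩA.
φ-f₂ : φ ⊛ f₂ ≈ f₁ ⊛ f₁
φ-f₂ = R.trans
  (solve 2 (λ x y → y :* x :* x :* y := x :* y :* (x :* y)) R.refl (P∞ -1ℤ 1 2) f₂)
  (R.sym (R.*-cong f₁-2 f₁-2))
  where open Solver

ψ-f₁ : ψ ⊛ f₁ ≈ f₂ ⊛ f₂
ψ-f₁ = begin
  ψ ⊛ f₁
    ≈⟨ ⊛-congʳ ψ f₁-2 ⟩
  η 4 ⊛ P∞ 1ℤ 1 4 ⊛ P∞ 1ℤ 3 4 ⊛ (P∞ -1ℤ 1 2 ⊛ f₂)
    ≈⟨ solve 5 (λ e a b c f → e :* a :* b :* (c :* f) := (a :* b) :* c :* e :* f) R.refl
         (η 4) (P∞ 1ℤ 1 4) (P∞ 1ℤ 3 4) (P∞ -1ℤ 1 2) f₂ ⟩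
  (P∞ 1ℤ 1 4 ⊛ P∞ 1ℤ 3 4) ⊛ P∞ -1ℤ 1 2 ⊛ η 4 ⊛ f₂
    ≈⟨ ⊛-congˡ f₂ (⊛-congˡ (η 4) (⊛-congˡ (P∞ -1ℤ 1 2) (P∞-2 1 2 1ℤ))) ⟨
  P∞ 1ℤ 1 2 ⊛ P∞ -1ℤ 1 2 ⊛ η 4 ⊛ f₂
    ≈⟨ ⊛-congˡ f₂ (⊛-congˡ (η 4) (P∞-± 1 2)) ⟩
  P∞ -1ℤ 2 4 ⊛ η 4 ⊛ f₂
    ≈⟨ ⊛-congˡ f₂ (P∞-2 2 2 -1ℤ) ⟨
  f₂ ⊛ f₂ ∎
  where
  open ≈-Reasoning
  open Solver

φ-ψ : φ ⊛ ψ ≈ h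
φ-ψ = ⊛-cancel (head-⊛ {f₁} {f₂} (η-head 1) (η-head 2)) (begin
  f₁ ⊛ f₂ ⊛ (φ ⊛ ψ)
    ≈⟨ solve 4 (λ a b x y → a :* b :* (x :* y) := x :* b :* (y :* a)) R.refl f₁ f₂ φ ψ ⟩
  φ ⊛ f₂ ⊛ (ψ ⊛ f₁)
    ≈⟨ R.*-cong φ-f₂ ψ-f₁ ⟩
  f₁ ⊛ f₁ ⊛ (f₂ ⊛ f₂)
    ≈⟨ solve 2 (λ a b → a :* a :* (b :* b) := a :* b :* (a :* b)) R.refl f₁ f₂ ⟩
  f₁ ⊛ f₂ ⊛ h ∎)
  where
  open ≈-Reasoning
  open Solver

A-f₁-f₆ : A ⊛ (f₁ ⊛ f₆) ≈ f₃ ⊛ f₃ ⊛ f₂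
A-f₁-f₆ = begin
  A ⊛ (f₁ ⊛ f₆)
    ≈⟨ ⊛-congʳ A (⊛-congˡ f₆ (P∞-3 1 1 -1ℤ)) ⟩
  f₃ ⊛ P∞ 1ℤ 1 3 ⊛ P∞ 1ℤ 2 3 ⊛ (P∞ -1ℤ 1 3 ⊛ P∞ -1ℤ 2 3 ⊛ f₃ ⊛ f₆)
    ≈⟨ solve 6 (λ e a b c d f → e :* a :* b :* (c :* d :* e :* f) := e :* e :* ((a :* c) :* (b :* d) :* f)) R.refl
         f₃ (P∞ 1ℤ 1 3) (P∞ 1ℤ 2 3) (P∞ -1ℤ 1 3) (P∞ -1ℤ 2 3) f₆ ⟩
  f₃ ⊛ f₃ ⊛ ((P∞ 1ℤ 1 3 ⊛ P∞ -1ℤ 1 3) ⊛ (P∞ 1ℤ 2 3 ⊛ P∞ -1ℤ 2 3) ⊛ f₆)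
    ≈⟨ ⊛-congʳ (f₃ ⊛ f₃) (⊛-congˡ f₆ (R.*-cong (P∞-± 1 3) (P∞-± 2 3))) ⟩
  f₃ ⊛ f₃ ⊛ (P∞ -1ℤ 2 6 ⊛ P∞ -1ℤ 4 6 ⊛ f₆)
    ≈⟨ ⊛-congʳ (f₃ ⊛ f₃) (P∞-3 2 2 -1ℤ) ⟨
  f₃ ⊛ f₃ ⊛ f₂ ∎
  where
  open ≈-Reasoning
  open Solver

Ω-f₂-f₃ : Ω ⊛ (f₂ ⊛ f₃) ≈ f₆ ⊛ f₆ ⊛ f₁
Ω-f₂-f₃ = begin
  Ω ⊛ (f₂ ⊛ f₃)
    ≈⟨ ⊛-congʳ Ω (⊛-congʳ f₂ (P∞-2 3 3 -1ℤ)) ⟩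
  f₆ ⊛ P∞ -1ℤ 1 6 ⊛ P∞ -1ℤ 5 6 ⊛ (f₂ ⊛ (P∞ -1ℤ 3 6 ⊛ f₆))
    ≈⟨ solve 5 (λ e a b f c → e :* a :* b :* (f :* (c :* e)) := e :* e :* ((a :* c :* b) :* f)) R.refl
         f₆ (P∞ -1ℤ 1 6) (P∞ -1ℤ 5 6) f₂ (P∞ -1ℤ 3 6) ⟩
  f₆ ⊛ f₆ ⊛ ((P∞ -1ℤ 1 6 ⊛ P∞ -1ℤ 3 6 ⊛ P∞ -1ℤ 5 6) ⊛ f₂)
    -- The classes 1, 3, 5 mod 6 make up the odd exponents.
    ≈⟨ ⊛-congʳ (f₆ ⊛ f₆) (⊛-congˡ f₂ (P∞-3 1 2 -1ℤ)) ⟨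
  f₆ ⊛ f₆ ⊛ (P∞ -1ℤ 1 2 ⊛ f₂)
    ≈⟨ ⊛-congʳ (f₆ ⊛ f₆) f₁-2 ⟨
  f₆ ⊛ f₆ ⊛ f₁ ∎
  where
  open ≈-Reasoning
  open Solver

Ω-A : Ω ⊛ A ≈ g
Ω-A = ⊛-cancel (head-⊛ {f₂ ⊛ f₃} {f₁ ⊛ f₆} (head-⊛ {f₂} {f₃} (η-head 2) (η-head 3)) (head-⊛ {f₁} {f₆} (η-head 1) (η-head 6))) (begin
  (f₂ ⊛ f₃) ⊛ (f₁ ⊛ f₆) ⊛ (Ω ⊛ A)
    ≈⟨ solve 4 (λ a b x y → a :* b :* (x :* y) := x :* a :* (y :* b)) R.refl (f₂ ⊛ f₃) (f₁ ⊛ f₆) Ω A ⟩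
  Ω ⊛ (f₂ ⊛ f₃) ⊛ (A ⊛ (f₁ ⊛ f₆))
    ≈⟨ R.*-cong Ω-f₂-f₃ A-f₁-f₆ ⟩
  f₆ ⊛ f₆ ⊛ f₁ ⊛ (f₃ ⊛ f₃ ⊛ f₂)
    ≈⟨ solve 4 (λ a b c d → d :* d :* a :* (c :* c :* b) := b :* c :* (a :* d) :* (c :* d)) R.refl f₁ f₂ f₃ f₆ ⟩
  (f₂ ⊛ f₃) ⊛ (f₁ ⊛ f₆) ⊛ g ∎)
  where
  open ≈-Reasoning
  open Solver

-- Theta series and their 3-dissections

V-term : ∀ ε i d k → V (term ε i d k) ≈ term ε (i ℕ.* 3) (d ℕ.* 3) k
V-term ε i d zero = V-const 1ℤ
V-term ε i d (suc k) = R.trans (V-⊛ (term ε i d k) (mono ε (i ℕ.+ k ℕ.* d))) (R.*-cong (V-term ε i d k)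
  (R.trans (V-mono ε (i ℕ.+ k ℕ.* d))
    (mono-≡ {ε} refl (solve 3 (λ i d N → (i :+ N :* d) :* con 3 := i :* con 3 :+ N :* (d :* con 3)) refl i d k))))
  where open ℕSolver

term-suc : ∀ ε i d k → term ε i d (suc k) ≈ mono ε i ⊛ term ε (i ℕ.+ d) d k
term-suc ε i d zero = R.trans (R.*-identityˡ (mono ε (i ℕ.+ 0)))
  (R.trans (mono-≡ {ε} refl (ℕₚ.+-identityʳ i)) (R.sym (R.*-identityʳ (mono ε i))))
term-suc ε i d (suc k) = R.trans
  (R.*-cong (term-suc ε i d k) (mono-≡ {ε} refl (sym (ℕₚ.+-assoc i d (k ℕ.* d)))))
  (R.*-assoc (mono ε i) (term ε (i ℕ.+ d) d k) (mono ε (i ℕ.+ d ℕ.+ k ℕ.* d)))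

-- The exponents are quadratic in the index with second difference d, so every second term again
-- forms such a sequence, with second difference 4d; for every third term it is 9d.
term-2 : ∀ ε i d r k → term ε i d (r ℕ.+ k ℕ.* 2) ≈
  term ε i d r ⊛ term (ε ℤ.* ε) (i ℕ.* 2 ℕ.+ r ℕ.* d ℕ.* 2 ℕ.+ d) (d ℕ.* 4) k
term-2 ε i d r zero = R.trans (≡⇒≈ (cong (term ε i d) (ℕₚ.+-identityʳ r))) (R.sym (R.*-identityʳ (term ε i d r)))
term-2 ε i d r (suc k) = R.trans (≡⇒≈ (cong (term ε i d) (trans (ℕₚ.+-suc r (suc (k ℕ.* 2))) (cong suc (ℕₚ.+-suc r (k ℕ.* 2))))))
  (R.trans (R.*-assoc (term ε i d n) (mono ε (i ℕ.+ n ℕ.* d)) (mono ε (i ℕ.+ suc n ℕ.* d)))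
  (R.trans (R.*-cong (term-2 ε i d r k) (R.trans (mono-⊛ ε (i ℕ.+ n ℕ.* d) ε (i ℕ.+ suc n ℕ.* d))
      (mono-≡ {ε ℤ.* ε} refl (solve 4 (λ i d r k → let n = r :+ k :* con 2 in
        i :+ n :* d :+ (i :+ (d :+ n :* d)) := i :* con 2 :+ r :* d :* con 2 :+ d :+ k :* (d :* con 4)) refl i d r k))))
    (R.*-assoc (term ε i d r) (term (ε ℤ.* ε) i' (d ℕ.* 4) k) (mono (ε ℤ.* ε) (i' ℕ.+ k ℕ.* (d ℕ.* 4))))))
  where
  open ℕSolver
  n i' : ℕ
  n = r ℕ.+ k ℕ.* 2
  i' = i ℕ.* 2 ℕ.+ r ℕ.* d ℕ.* 2 ℕ.+ d

term-3 : ∀ ε i d r k → term ε i d (r ℕ.+ k ℕ.* 3) ≈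
  term ε i d r ⊛ term (ε ℤ.* ε ℤ.* ε) (i ℕ.* 3 ℕ.+ r ℕ.* d ℕ.* 3 ℕ.+ d ℕ.* 3) (d ℕ.* 9) k
term-3 ε i d r zero = R.trans (≡⇒≈ (cong (term ε i d) (ℕₚ.+-identityʳ r))) (R.sym (R.*-identityʳ (term ε i d r)))
term-3 ε i d r (suc k) = R.trans (≡⇒≈ (cong (term ε i d)
    (trans (ℕₚ.+-suc r (2 ℕ.+ k ℕ.* 3)) (cong suc (trans (ℕₚ.+-suc r (suc (k ℕ.* 3))) (cong suc (ℕₚ.+-suc r (k ℕ.* 3))))))))
  (R.trans (S.solve 4 (λ t a b c → t S.:* a S.:* b S.:* c S.:= t S.:* (a S.:* b S.:* c)) R.refl
    (term ε i d n) (mono ε (i ℕ.+ n ℕ.* d)) (mono ε (i ℕ.+ suc n ℕ.* d)) (mono ε (i ℕ.+ suc (suc n) ℕ.* d)))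
  (R.trans (R.*-cong (term-3 ε i d r k) (R.trans
      (⊛-congˡ (mono ε (i ℕ.+ suc (suc n) ℕ.* d)) (mono-⊛ ε (i ℕ.+ n ℕ.* d) ε (i ℕ.+ suc n ℕ.* d)))
      (R.trans (mono-⊛ (ε ℤ.* ε) (i ℕ.+ n ℕ.* d ℕ.+ (i ℕ.+ suc n ℕ.* d)) ε (i ℕ.+ suc (suc n) ℕ.* d))
      (mono-≡ {ε ℤ.* ε ℤ.* ε} refl (solve 4 (λ i d r k → let n = r :+ k :* con 3 in
        i :+ n :* d :+ (i :+ (d :+ n :* d)) :+ (i :+ (d :+ (d :+ n :* d))) :=
        i :* con 3 :+ r :* d :* con 3 :+ d :* con 3 :+ k :* (d :* con 9)) refl i d r k)))))
    (R.*-assoc (term ε i d r) (term (ε ℤ.* ε ℤ.* ε) i' (d ℕ.* 9) k) (mono (ε ℤ.* ε ℤ.* ε) (i' ℕ.+ k ℕ.* (d ℕ.* 9))))))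
  where
  open ℕSolver
  module S = Solver
  n i' : ℕ
  n = r ℕ.+ k ℕ.* 3
  i' = i ℕ.* 3 ℕ.+ r ℕ.* d ℕ.* 3 ℕ.+ d ℕ.* 3

-- θ without the last term of one side, so that its terms fall evenly into classes mod 3
θ' : ℤ → ℕ → ℕ → ℕ → Series
θ' ε i j N = sum N (term ε j (i ℕ.+ j)) ⊕ sum N (λ k → term ε i (i ℕ.+ j) (suc k))

θ'-⟶ : ∀ ε i j → 1 ≤ j → ∀ {a} → θ ε i j ⟶ a → θ' ε i j ⟶ a
θ'-⟶ ε i j 1≤j {a} p = ⟶-cong eq (converges λ M N M≤N → ≈[]-trans
  (mod-q^ (⟶-⊕ p (⟶-⊖ D-⟶0)) M N M≤N)
  (≈⇒≈[] M (solve 1 (λ a → a :- con 0ℤ := a) R.refl a)))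
  where
  open Solver
  D E : ℕ → Series
  D = term ε j (i ℕ.+ j)
  E = term ε i (i ℕ.+ j)
  D-⟶0 : D ⟶ 0#
  D-⟶0 = converges λ M N M≤N → ≈[]-mono M≤N (term-small ε j (i ℕ.+ j) N 1≤j)
  eq : ∀ N → θ' ε i j N ≈ θ ε i j N ⊕ ⊖ D N
  eq N = begin
    sum N D ⊕ sum N (λ k → E (suc k))
      ≈⟨ solve 3 (λ s d e → s :+ e := (s :+ d) :+ e :- d) R.refl (sum N D) (D N) (sum N (λ k → E (suc k))) ⟩
    sum (suc N) D ⊕ sum N (λ k → E (suc k)) ⊕ ⊖ D N
      ≈⟨ ⊕-congˡ (⊖ D N) (⊕-congˡ (sum N (λ k → E (suc k))) (sum-head N D)) ⟩
    1# ⊕ sum N (λ k → D (suc k)) ⊕ sum N (λ k → E (suc k)) ⊕ ⊖ D N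
      ≈⟨ solve 3 (λ s e d → con 1ℤ :+ s :+ e :- d := (con 1ℤ :+ e) :+ s :- d) R.refl
           (sum N (λ k → D (suc k))) (sum N (λ k → E (suc k))) (D N) ⟩
    (1# ⊕ sum N (λ k → E (suc k))) ⊕ sum N (λ k → D (suc k)) ⊕ ⊖ D N
      ≈⟨ ⊕-congˡ (⊖ D N) (⊕-congˡ (sum N (λ k → D (suc k))) (sum-head N E)) ⟨
    θ ε i j N ⊕ ⊖ D N ∎
    where open ≈-Reasoning

V-sum : ∀ N f → V (sum N f) ≈ sum N (λ k → V (f k))
V-sum zero f = V-const 0ℤ
V-sum (suc N) f = R.trans (V-⊕ (sum N f) (f N)) (⊕-congˡ (V (f N)) (V-sum N f))

φ-sum : θ' -1ℤ 1 1 ⟶ φ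
φ-sum = θ'-⟶ -1ℤ 1 1 (s≤s z≤n) (JacobiTripleProduct.theorem -1ℤ refl 1 1 (s≤s z≤n) (s≤s z≤n))

Ω-sum : θ' -1ℤ 1 5 ⟶ Ω
Ω-sum = θ'-⟶ -1ℤ 1 5 (s≤s z≤n) (JacobiTripleProduct.theorem -1ℤ refl 1 5 (s≤s z≤n) (s≤s z≤n))

A-sum : θ' 1ℤ 1 2 ⟶ A
A-sum = θ'-⟶ 1ℤ 1 2 (s≤s z≤n) (JacobiTripleProduct.theorem 1ℤ refl 1 2 (s≤s z≤n) (s≤s z≤n))

-- The one-sided form ∑ q^(k(k+1)/2) of f(q,q³): even and odd k give its two halves. It is easier to
-- dissect than the two-sided form.
ψ-sum : (λ N → sum (N ℕ.* 2) (term 1ℤ 1 1)) ⟶ ψ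
ψ-sum = ⟶-cong eq (θ'-⟶ 1ℤ 1 3 (s≤s z≤n) (JacobiTripleProduct.theorem 1ℤ refl 1 3 (s≤s z≤n) (s≤s z≤n)))
  where
  eq : ∀ N → sum (N ℕ.* 2) (term 1ℤ 1 1) ≈ θ' 1ℤ 1 3 N
  eq N = R.trans (sum-2 N (term 1ℤ 1 1)) (R.+-cong
    (sum-cong N λ k → R.trans (term-2 1ℤ 1 1 0 k) (R.*-identityˡ (term 1ℤ 3 4 k)))
    (sum-cong N λ k → R.trans (term-2 1ℤ 1 1 1 k)
      (R.trans (⊛-congˡ (term 1ℤ 5 4 k) (R.*-identityˡ (mono 1ℤ 1))) (R.sym (term-suc 1ℤ 1 4 k)))))

-- In φ(-q) = ∑ (-1)ᵏ q^(k²) over all integers k, the multiples of 3 give φ(-q⁹). The other two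
-- classes have k² ≡ 1 mod 3 and are exchanged by k ↦ -k, whence the factor 2.
φ-3 : φ ≈ V (V φ) ⊕ ⊖ (const (+ 2) ⊛ q ⊛ V Ω)
φ-3 = ⟶-unique (⟶-subseq (ℕ._* 3) (λ N → ℕₚ.m≤m*n N 3) φ-sum)
  (⟶-cong eq (⟶-⊕ (⟶-V (⟶-V φ-sum)) (⟶-⊖ (⟶-⊛ (⟶-const (const (+ 2) ⊛ q)) (⟶-V Ω-sum)))))
  where
  t : ℕ → Series
  t = term -1ℤ 1 2
  -q : Series
  -q = mono -1ℤ 1
  t₀ : ∀ k → t (k ℕ.* 3) ≈ V (V (t k))
  t₀ k = R.trans (term-3 -1ℤ 1 2 0 k) (R.trans (R.*-identityˡ (term -1ℤ 9 18 k))
    (R.sym (R.trans (V-cong (V-term -1ℤ 1 2 k)) (V-term -1ℤ 3 6 k))))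
  t₁ : ∀ k → t (1 ℕ.+ k ℕ.* 3) ≈ -q ⊛ V (term -1ℤ 5 6 k)
  t₁ k = R.trans (term-3 -1ℤ 1 2 1 k) (R.*-cong (R.*-identityˡ -q) (R.sym (V-term -1ℤ 5 6 k)))
  t₂ : ∀ k → t (2 ℕ.+ k ℕ.* 3) ≈ -q ⊛ V (term -1ℤ 1 6 (suc k))
  t₂ k = R.trans (term-3 -1ℤ 1 2 2 k) (R.trans
    (⊛-congˡ (term -1ℤ 21 18 k) (⊛-congˡ (mono -1ℤ 3) (R.*-identityˡ -q)))
    (R.trans (R.*-assoc -q (mono -1ℤ 3) (term -1ℤ 21 18 k))
    (⊛-congʳ -q (R.sym (R.trans (V-term -1ℤ 1 6 (suc k)) (term-suc -1ℤ 3 18 k))))))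
  t₃ : ∀ k → t (3 ℕ.+ k ℕ.* 3) ≈ V (V (t (suc k)))
  t₃ k = t₀ (suc k)
  eq : ∀ N → θ' -1ℤ 1 1 (N ℕ.* 3) ≈ V (V (θ' -1ℤ 1 1 N)) ⊕ ⊖ (const (+ 2) ⊛ q ⊛ V (θ' -1ℤ 1 5 N))
  eq N = begin
    sum (N ℕ.* 3) t ⊕ sum (N ℕ.* 3) (λ k → t (suc k))
      ≈⟨ R.+-cong (sum-3 N t) (sum-3 N (λ k → t (suc k))) ⟩
    (sum N (λ k → t (k ℕ.* 3)) ⊕ sum N (λ k → t (1 ℕ.+ k ℕ.* 3)) ⊕ sum N (λ k → t (2 ℕ.+ k ℕ.* 3))) ⊕
    (sum N (λ k → t (1 ℕ.+ k ℕ.* 3)) ⊕ sum N (λ k → t (2 ℕ.+ k ℕ.* 3)) ⊕ sum N (λ k → t (3 ℕ.+ k ℕ.* 3)))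
      ≈⟨ R.+-cong (R.+-cong (R.+-cong s₀ s₁) s₂) (R.+-cong (R.+-cong s₁ s₂) s₃) ⟩
    (V (V T₀) ⊕ -q ⊛ V D ⊕ -q ⊛ V E) ⊕ (-q ⊛ V D ⊕ -q ⊛ V E ⊕ V (V T₁))
      ≈⟨ R.+-cong (R.+-cong (⊕-congʳ (V (V T₀)) (⊛-congˡ (V D) -q≈)) (⊛-congˡ (V E) -q≈))
                  (⊕-congˡ (V (V T₁)) (R.+-cong (⊛-congˡ (V D) -q≈) (⊛-congˡ (V E) -q≈))) ⟩
    (V (V T₀) ⊕ ⊖ q ⊛ V D ⊕ ⊖ q ⊛ V E) ⊕ (⊖ q ⊛ V D ⊕ ⊖ q ⊛ V E ⊕ V (V T₁))
      ≈⟨ solve 5 (λ a b q d e → (a :+ (:- q) :* d :+ (:- q) :* e) :+ ((:- q) :* d :+ (:- q) :* e :+ b) :=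
            a :+ b :- con (+ 2) :* q :* (d :+ e)) R.refl (V (V T₀)) (V (V T₁)) q (V D) (V E) ⟩
    V (V T₀) ⊕ V (V T₁) ⊕ ⊖ (const (+ 2) ⊛ q ⊛ (V D ⊕ V E))
      ≈⟨ R.+-cong (R.trans (V-cong (V-⊕ T₀ T₁)) (V-⊕ (V T₀) (V T₁))) (R.-‿cong (⊛-congʳ (const (+ 2) ⊛ q) (V-⊕ D E))) ⟨
    V (V (θ' -1ℤ 1 1 N)) ⊕ ⊖ (const (+ 2) ⊛ q ⊛ V (θ' -1ℤ 1 5 N)) ∎
    where
    open ≈-Reasoning
    open Solver
    T₀ T₁ D E : Series
    T₀ = sum N t
    T₁ = sum N (λ k → t (suc k))
    D = sum N (term -1ℤ 5 6)
    E = sum N (λ k → term -1ℤ 1 6 (suc k))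
    -q≈ : -q ≈ ⊖ q
    -q≈ = mono-neg 1ℤ 1
    s₀ : sum N (λ k → t (k ℕ.* 3)) ≈ V (V T₀)
    s₀ = R.trans (sum-cong N t₀) (R.sym (R.trans (V-cong (V-sum N t)) (V-sum N (λ k → V (t k)))))
    s₃ : sum N (λ k → t (3 ℕ.+ k ℕ.* 3)) ≈ V (V T₁)
    s₃ = R.trans (sum-cong N t₃) (R.sym (R.trans (V-cong (V-sum N (λ k → t (suc k)))) (V-sum N (λ k → V (t (suc k))))))
    s₁ : sum N (λ k → t (1 ℕ.+ k ℕ.* 3)) ≈ -q ⊛ V D
    s₁ = R.trans (sum-cong N t₁) (R.sym (R.trans (⊛-congʳ -q (V-sum N (term -1ℤ 5 6))) (sum-⊛ N -q (λ k → V (term -1ℤ 5 6 k)))))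
    s₂ : sum N (λ k → t (2 ℕ.+ k ℕ.* 3)) ≈ -q ⊛ V E
    s₂ = R.trans (sum-cong N t₂) (R.sym (R.trans (⊛-congʳ -q (V-sum N (λ k → term -1ℤ 1 6 (suc k))))
      (sum-⊛ N -q (λ k → V (term -1ℤ 1 6 (suc k))))))

-- Triangular numbers k(k+1)/2 are 0, 1, 0 mod 3 for k ≡ 0, 1, 2, and for k = 3l + 1 they equal 1 +
-- 9 · l(l+1)/2. The classes 0 and 2 are the two halves of A(q³).
ψ-3 : ψ ≈ V A ⊕ q ⊛ V (V ψ)
ψ-3 = ⟶-unique (⟶-subseq (ℕ._* 3) (λ N → ℕₚ.m≤m*n N 3) ψ-sum)
  (⟶-cong eq (⟶-⊕ (⟶-V (⟶-subseq (ℕ._* 2) (λ N → ℕₚ.m≤m*n N 2) A-sum)) (⟶-⊛ (⟶-const q) (⟶-V (⟶-V ψ-sum)))))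
  where
  t : ℕ → Series
  t = term 1ℤ 1 1
  t₀ : ∀ k → t (k ℕ.* 3) ≈ V (term 1ℤ 2 3 k)
  t₀ k = R.trans (term-3 1ℤ 1 1 0 k) (R.trans (R.*-identityˡ (term 1ℤ 6 9 k)) (R.sym (V-term 1ℤ 2 3 k)))
  t₁ : ∀ k → t (1 ℕ.+ k ℕ.* 3) ≈ q ⊛ V (V (t k))
  t₁ k = R.trans (term-3 1ℤ 1 1 1 k) (R.*-cong (R.*-identityˡ q)
    (R.sym (R.trans (V-cong (V-term 1ℤ 1 1 k)) (V-term 1ℤ 3 3 k))))
  t₂ : ∀ k → t (2 ℕ.+ k ℕ.* 3) ≈ V (term 1ℤ 1 3 (suc k))
  t₂ k = R.trans (term-3 1ℤ 1 1 2 k) (R.trans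
    (⊛-congˡ (term 1ℤ 12 9 k) (R.trans (⊛-congˡ (mono 1ℤ 2) (R.*-identityˡ q)) (mono-⊛ 1ℤ 1 1ℤ 2)))
    (R.sym (R.trans (V-term 1ℤ 1 3 (suc k)) (term-suc 1ℤ 3 9 k))))
  eq : ∀ N → sum (N ℕ.* 3 ℕ.* 2) t ≈ V (θ' 1ℤ 1 2 (N ℕ.* 2)) ⊕ q ⊛ V (V (sum (N ℕ.* 2) t))
  eq N = begin
    sum (N ℕ.* 3 ℕ.* 2) t
      ≈⟨ ≡⇒≈ (cong (λ n → sum n t) (ℕSolver.solve 1 (λ N → N ℕSolver.:* ℕSolver.con 3 ℕSolver.:* ℕSolver.con 2 ℕSolver.:= N ℕSolver.:* ℕSolver.con 2 ℕSolver.:* ℕSolver.con 3) refl N)) ⟩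
    sum (M ℕ.* 3) t
      ≈⟨ sum-3 M t ⟩
    sum M (λ k → t (k ℕ.* 3)) ⊕ sum M (λ k → t (1 ℕ.+ k ℕ.* 3)) ⊕ sum M (λ k → t (2 ℕ.+ k ℕ.* 3))
      ≈⟨ R.+-cong (R.+-cong s₀ s₁) s₂ ⟩
    V D ⊕ q ⊛ V (V T₀) ⊕ V E
      ≈⟨ solve 3 (λ d t e → d :+ t :+ e := d :+ e :+ t) R.refl (V D) (q ⊛ V (V T₀)) (V E) ⟩
    V D ⊕ V E ⊕ q ⊛ V (V T₀)
      ≈⟨ ⊕-congˡ (q ⊛ V (V T₀)) (V-⊕ D E) ⟨
    V (θ' 1ℤ 1 2 M) ⊕ q ⊛ V (V T₀) ∎
    where
    open ≈-Reasoning
    open Solver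
    M : ℕ
    M = N ℕ.* 2
    T₀ D E : Series
    T₀ = sum M t
    D = sum M (term 1ℤ 2 3)
    E = sum M (λ k → term 1ℤ 1 3 (suc k))
    s₀ : sum M (λ k → t (k ℕ.* 3)) ≈ V D
    s₀ = R.trans (sum-cong M t₀) (R.sym (V-sum M (term 1ℤ 2 3)))
    s₁ : sum M (λ k → t (1 ℕ.+ k ℕ.* 3)) ≈ q ⊛ V (V T₀)
    s₁ = R.trans (sum-cong M t₁) (R.sym (R.trans (⊛-congʳ q (R.trans (V-cong (V-sum M t)) (V-sum M (λ k → V (t k)))))
      (sum-⊛ M q (λ k → V (V (t k))))))
    s₂ : sum M (λ k → t (2 ℕ.+ k ℕ.* 3)) ≈ V E
    s₂ = R.trans (sum-cong M t₂) (R.sym (V-sum M (λ k → term 1ℤ 1 3 (suc k))))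

-- The 3-dissection and the norm of f₁f₂

dissected : Series → Series → Series → Series
dissected x y z = V x ⊕ q ⊛ V y ⊕ q ⊛ q ⊛ V z

V-q : V q ≈ q ⊛ q ⊛ q
V-q = R.trans (V-mono 1ℤ 1) (R.sym (R.trans (⊛-congˡ q (mono-⊛ 1ℤ 1 1ℤ 1)) (mono-⊛ 1ℤ 2 1ℤ 1)))

dissected-cong : ∀ {x y z x' y' z'} → x ≈ x' → y ≈ y' → z ≈ z' → dissected x y z ≈ dissected x' y' z'
dissected-cong p r s = R.+-cong (R.+-cong (V-cong p) (⊛-congʳ q (V-cong r))) (⊛-congʳ (q ⊛ q) (V-cong s))

module _ (x y z : Series) where
  private
    step₀ : ∀ {a b c} r → U r (V x) ≈ a → U r (q ⊛ V y) ≈ b → U r (q ⊛ (q ⊛ V z)) ≈ c →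
            U r (dissected x y z) ≈ a ⊕ b ⊕ c
    step₀ r p s t = R.trans (U-⊕ r (V x ⊕ q ⊛ V y) (q ⊛ q ⊛ V z))
      (R.+-cong (R.trans (U-⊕ r (V x) (q ⊛ V y)) (R.+-cong p s))
        (R.trans (U-cong r (R.*-assoc q q (V z))) t))

  U₀-dissected : U 0 (dissected x y z) ≈ x
  U₀-dissected = R.trans
    (step₀ 0 (U₀-V x) (R.trans (U₀-q⊛ (V y)) (⊛-congʳ q (U₂-V y)))
      (R.trans (U₀-q⊛ (q ⊛ V z)) (⊛-congʳ q (R.trans (U₂-q⊛ (V z)) (U₁-V z)))))
    (solve 2 (λ x q → x :+ q :* con 0ℤ :+ q :* con 0ℤ := x) R.refl x q)
    where open Solver

  U₁-dissected : U 1 (dissected x y z) ≈ y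
  U₁-dissected = R.trans
    (step₀ 1 (U₁-V x) (R.trans (U₁-q⊛ (V y)) (U₀-V y))
      (R.trans (U₁-q⊛ (q ⊛ V z)) (R.trans (U₀-q⊛ (V z)) (⊛-congʳ q (U₂-V z)))))
    (solve 2 (λ y q → con 0ℤ :+ y :+ q :* con 0ℤ := y) R.refl y q)
    where open Solver

  U₂-dissected : U 2 (dissected x y z) ≈ z
  U₂-dissected = R.trans
    (step₀ 2 (U₂-V x) (R.trans (U₂-q⊛ (V y)) (U₁-V y))
      (R.trans (U₂-q⊛ (q ⊛ V z)) (R.trans (U₁-q⊛ (V z)) (U₀-V z))))
    (solve 1 (λ z → con 0ℤ :+ con 0ℤ :+ z := z) R.refl z)
    where open Solver

dissect : ∀ X → X ≈ dissected (U 0 X) (U 1 X) (U 2 X)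
dissect X = ≈-from-U (R.sym (U₀-dissected (U 0 X) (U 1 X) (U 2 X)))
  (R.sym (U₁-dissected (U 0 X) (U 1 X) (U 2 X))) (R.sym (U₂-dissected (U 0 X) (U 1 X) (U 2 X)))

dissected-⊛ : ∀ x y z a b c → dissected x y z ⊛ dissected a b c ≈
  dissected (x ⊛ a ⊕ q ⊛ (y ⊛ c ⊕ z ⊛ b)) (x ⊛ b ⊕ y ⊛ a ⊕ q ⊛ (z ⊛ c)) (x ⊛ c ⊕ y ⊛ b ⊕ z ⊛ a)
dissected-⊛ x y z a b c = begin
  dissected x y z ⊛ dissected a b c
    ≈⟨ solve 7 (λ q x y z a b c →
         (x :+ q :* y :+ q :* q :* z) :* (a :+ q :* b :+ q :* q :* c) :=
         (x :* a :+ q :* q :* q :* (y :* c :+ z :* b)) :+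
         q :* (x :* b :+ y :* a :+ q :* q :* q :* (z :* c)) :+
         q :* q :* (x :* c :+ y :* b :+ z :* a)) R.refl q (V x) (V y) (V z) (V a) (V b) (V c) ⟩
  (V x ⊛ V a ⊕ q ⊛ q ⊛ q ⊛ (V y ⊛ V c ⊕ V z ⊛ V b)) ⊕
  q ⊛ (V x ⊛ V b ⊕ V y ⊛ V a ⊕ q ⊛ q ⊛ q ⊛ (V z ⊛ V c)) ⊕
  q ⊛ q ⊛ (V x ⊛ V c ⊕ V y ⊛ V b ⊕ V z ⊛ V a)
    ≈⟨ R.+-cong (R.+-cong
         (V-⊕′ (V-⊛ x a) (V-⊛′ V-q (V-⊕′ (V-⊛ y c) (V-⊛ z b))))
         (⊛-congʳ q (V-⊕′ (V-⊕′ (V-⊛ x b) (V-⊛ y a)) (V-⊛′ V-q (V-⊛ z c)))))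
         (⊛-congʳ (q ⊛ q) (V-⊕′ (V-⊕′ (V-⊛ x c) (V-⊛ y b)) (V-⊛ z a))) ⟨
  dissected (x ⊛ a ⊕ q ⊛ (y ⊛ c ⊕ z ⊛ b)) (x ⊛ b ⊕ y ⊛ a ⊕ q ⊛ (z ⊛ c)) (x ⊛ c ⊕ y ⊛ b ⊕ z ⊛ a) ∎
  where
  open ≈-Reasoning
  open Solver
  V-⊕′ : ∀ {x y X Y} → V x ≈ X → V y ≈ Y → V (x ⊕ y) ≈ X ⊕ Y
  V-⊕′ {x} {y} p r = R.trans (V-⊕ x y) (R.+-cong p r)
  V-⊛′ : ∀ {x y X Y} → V x ≈ X → V y ≈ Y → V (x ⊛ y) ≈ X ⊛ Y
  V-⊛′ {x} {y} p r = R.trans (V-⊛ x y) (R.*-cong p r)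

-- the norm from ℤ[[q]] to ℤ[[q³]], read as a series in q
ν : Series → Series → Series → Series
ν x y z = x ⊛ x ⊛ x ⊕ q ⊛ (y ⊛ y ⊛ y) ⊕ q ⊛ q ⊛ (z ⊛ z ⊛ z) ⊕ ⊖ (const (+ 3) ⊛ q ⊛ (x ⊛ y ⊛ z))

ν-cong : ∀ {x y z x' y' z'} → x ≈ x' → y ≈ y' → z ≈ z' → ν x y z ≈ ν x' y' z'
ν-cong p r s = R.+-cong (R.+-cong (R.+-cong (R.*-cong (R.*-cong p p) p)
  (⊛-congʳ q (R.*-cong (R.*-cong r r) r))) (⊛-congʳ (q ⊛ q) (R.*-cong (R.*-cong s s) s)))
  (R.-‿cong (⊛-congʳ (const (+ 3) ⊛ q) (R.*-cong (R.*-cong p r) s)))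

Norm : Series → Series
Norm X = ν (U 0 X) (U 1 X) (U 2 X)

Norm-dissected : ∀ {X} x y z → X ≈ dissected x y z → Norm X ≈ ν x y z
Norm-dissected x y z p = ν-cong (R.trans (U-cong 0 p) (U₀-dissected x y z))
  (R.trans (U-cong 1 p) (U₁-dissected x y z)) (R.trans (U-cong 2 p) (U₂-dissected x y z))

-- Through `dissected-⊛` this becomes the multiplicativity of the norm form of a pure cubic
-- extension, a polynomial identity.
Norm-⊛ : ∀ X Y → Norm (X ⊛ Y) ≈ Norm X ⊛ Norm Y
Norm-⊛ X Y = R.trans
  (Norm-dissected _ _ _ (R.trans (R.*-cong (dissect X) (dissect Y))
    (dissected-⊛ (U 0 X) (U 1 X) (U 2 X) (U 0 Y) (U 1 Y) (U 2 Y))))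
  (solve 7 (λ q x y z a b c →
    N q (x :* a :+ q :* (y :* c :+ z :* b)) (x :* b :+ y :* a :+ q :* (z :* c)) (x :* c :+ y :* b :+ z :* a) :=
    N q x y z :* N q a b c) R.refl q (U 0 X) (U 1 X) (U 2 X) (U 0 Y) (U 1 Y) (U 2 Y))
  where
  open Solver
  N : ∀ {n} → Polynomial n → Polynomial n → Polynomial n → Polynomial n → Polynomial n
  N q x y z = x :* x :* x :+ q :* (y :* y :* y) :+ q :* q :* (z :* z :* z) :- con (+ 3) :* q :* (x :* y :* z)

Norm-cong : ∀ {X Y} → X ≈ Y → Norm X ≈ Norm Y
Norm-cong p = ν-cong (U-cong 0 p) (U-cong 1 p) (U-cong 2 p)

Norm-V : ∀ a → Norm (V a) ≈ a ⊛ a ⊛ a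
Norm-V a = R.trans (Norm-dissected a 0# 0# (R.sym (R.trans
    (R.+-cong (⊕-congʳ (V a) (⊛-congʳ q (V-const 0ℤ))) (⊛-congʳ (q ⊛ q) (V-const 0ℤ)))
    (solve 2 (λ q a → a :+ q :* con 0ℤ :+ q :* q :* con 0ℤ := a) R.refl q (V a)))))
  (solve 2 (λ q a → a :* a :* a :+ q :* (con 0ℤ :* con 0ℤ :* con 0ℤ) :+ q :* q :* (con 0ℤ :* con 0ℤ :* con 0ℤ)
    :- con (+ 3) :* q :* (a :* con 0ℤ :* con 0ℤ) := a :* a :* a) R.refl q a)
  where open Solver

Norm-⟶ : ∀ {s a} → s ⟶ a → (λ N → Norm (s (N ℕ.* 3))) ⟶ Norm a
Norm-⟶ {s} {a} p = ⟶-⊕ (⟶-⊕ (⟶-⊕ (cube u₀) (⟶-⊛ (⟶-const q) (cube u₁))) (⟶-⊛ (⟶-const (q ⊛ q)) (cube u₂)))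
  (⟶-⊖ (⟶-⊛ (⟶-const (const (+ 3) ⊛ q)) (⟶-⊛ (⟶-⊛ u₀ u₁) u₂)))
  where
  u₀ : (λ N → U 0 (s (N ℕ.* 3))) ⟶ U 0 a
  u₀ = ⟶-U 0 (s≤s z≤n) p
  u₁ : (λ N → U 1 (s (N ℕ.* 3))) ⟶ U 1 a
  u₁ = ⟶-U 1 (s≤s (s≤s z≤n)) p
  u₂ : (λ N → U 2 (s (N ℕ.* 3))) ⟶ U 2 a
  u₂ = ⟶-U 2 (s≤s (s≤s (s≤s z≤n))) p
  cube : ∀ {s a} → s ⟶ a → (λ N → s N ⊛ s N ⊛ s N) ⟶ a ⊛ a ⊛ a
  cube p = ⟶-⊛ (⟶-⊛ p p) p

data Residue± : ℕ → Set where
  res₁ : Residue± 1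
  res₂ : Residue± 2

-- For n prime to 3 the product of 1 - ωˢqⁿ over s mod 3 is 1 - q³ⁿ, which reads 1 - qⁿ after q³ ↦
-- q. In coordinates one of the three components vanishes, and with it the mixed term of `ν`.
Norm-factor : ∀ {r} → Residue± r → ∀ m → Norm (1# ⊕ mono -1ℤ (r ℕ.+ m ℕ.* 3)) ≈ 1# ⊕ mono -1ℤ (r ℕ.+ m ℕ.* 3)
Norm-factor {r} ρ m = go ρ
  where
  open Solver
  x : Series
  x = mono -1ℤ m
  x³ : x ⊛ x ⊛ x ≈ mono -1ℤ (m ℕ.* 3)
  x³ = R.trans (⊛-congˡ x (mono-⊛ -1ℤ m -1ℤ m)) (R.trans (mono-⊛ 1ℤ (m ℕ.+ m) -1ℤ m)
    (mono-≡ { -1ℤ} refl (ℕSolver.solve 1 (λ m → m ℕSolver.:+ m ℕSolver.:+ m ℕSolver.:= m ℕSolver.:* ℕSolver.con 3) refl m)))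
  qx³ : q ⊛ mono -1ℤ (m ℕ.* 3) ≈ mono -1ℤ (1 ℕ.+ m ℕ.* 3)
  qx³ = mono-⊛ 1ℤ 1 -1ℤ (m ℕ.* 3)
  q²x³ : q ⊛ q ⊛ mono -1ℤ (m ℕ.* 3) ≈ mono -1ℤ (2 ℕ.+ m ℕ.* 3)
  q²x³ = R.trans (⊛-congˡ (mono -1ℤ (m ℕ.* 3)) (mono-⊛ 1ℤ 1 1ℤ 1)) (mono-⊛ 1ℤ 2 -1ℤ (m ℕ.* 3))
  go : Residue± r → Norm (1# ⊕ mono -1ℤ (r ℕ.+ m ℕ.* 3)) ≈ 1# ⊕ mono -1ℤ (r ℕ.+ m ℕ.* 3)
  go res₁ = R.trans (Norm-dissected 1# x 0# (R.sym (R.trans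
      (R.+-cong (R.+-cong (V-const 1ℤ) (⊛-congʳ q (V-mono -1ℤ m))) (⊛-congʳ (q ⊛ q) (V-const 0ℤ)))
      (R.trans (solve 2 (λ q y → con 1ℤ :+ q :* y :+ q :* q :* con 0ℤ := con 1ℤ :+ q :* y) R.refl q (mono -1ℤ (m ℕ.* 3)))
        (⊕-congʳ 1# qx³)))))
    (R.trans (solve 2 (λ q x → con 1ℤ :* con 1ℤ :* con 1ℤ :+ q :* (x :* x :* x) :+ q :* q :* (con 0ℤ :* con 0ℤ :* con 0ℤ)
        :- con (+ 3) :* q :* (con 1ℤ :* x :* con 0ℤ) := con 1ℤ :+ q :* (x :* x :* x)) R.refl q x)
      (⊕-congʳ 1# (R.trans (⊛-congʳ q x³) qx³)))
  go res₂ = R.trans (Norm-dissected 1# 0# x (R.sym (R.trans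
      (R.+-cong (R.+-cong (V-const 1ℤ) (⊛-congʳ q (V-const 0ℤ))) (⊛-congʳ (q ⊛ q) (V-mono -1ℤ m)))
      (R.trans (solve 2 (λ q y → con 1ℤ :+ q :* con 0ℤ :+ q :* q :* y := con 1ℤ :+ q :* q :* y) R.refl q (mono -1ℤ (m ℕ.* 3)))
        (⊕-congʳ 1# q²x³)))))
    (R.trans (solve 2 (λ q x → con 1ℤ :* con 1ℤ :* con 1ℤ :+ q :* (con 0ℤ :* con 0ℤ :* con 0ℤ) :+ q :* q :* (x :* x :* x)
        :- con (+ 3) :* q :* (con 1ℤ :* con 0ℤ :* x) := con 1ℤ :+ q :* q :* (x :* x :* x)) R.refl q x)
      (⊕-congʳ 1# (R.trans (⊛-congʳ (q ⊛ q) x³) q²x³)))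

Norm-P∞ : ∀ {r} → Residue± r → ∀ m d .{{_ : NonZero d}} →
          Norm (P∞ -1ℤ (r ℕ.+ m ℕ.* 3) (d ℕ.* 3)) ≈ P∞ -1ℤ (r ℕ.+ m ℕ.* 3) (d ℕ.* 3)
Norm-P∞ {r} ρ m d = ⟶-unique (Norm-⟶ P-⟶′)
  (⟶-cong (λ N → fin (N ℕ.* 3)) (⟶-subseq (ℕ._* 3) (λ N → ℕₚ.m≤m*n N 3) P-⟶′))
  where
  i : ℕ
  i = r ℕ.+ m ℕ.* 3
  instance
    d3≢0 : NonZero (d ℕ.* 3)
    d3≢0 = ℕₚ.m*n≢0 d 3
  P-⟶′ : P -1ℤ i (d ℕ.* 3) ⟶ P∞ -1ℤ i (d ℕ.* 3)
  P-⟶′ = P-⟶ -1ℤ i (d ℕ.* 3)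
  factor : ∀ N → Norm (1# ⊕ mono -1ℤ (i ℕ.+ N ℕ.* (d ℕ.* 3))) ≈ 1# ⊕ mono -1ℤ (i ℕ.+ N ℕ.* (d ℕ.* 3))
  factor N = subst (λ e → Norm (1# ⊕ mono -1ℤ e) ≈ 1# ⊕ mono -1ℤ e)
    (ℕSolver.solve 4 (λ r m N d → let open ℕSolver in r :+ (m :+ N :* d) :* con 3 := r :+ m :* con 3 :+ N :* (d :* con 3)) refl r m N d)
    (Norm-factor ρ (m ℕ.+ N ℕ.* d))
  fin : ∀ N → Norm (P -1ℤ i (d ℕ.* 3) N) ≈ P -1ℤ i (d ℕ.* 3) N
  fin zero = R.trans (Norm-cong (R.sym (V-const 1ℤ))) (R.trans (Norm-V 1#) (R.trans (R.*-identityʳ (1# ⊛ 1#)) (R.*-identityʳ 1#)))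
  fin (suc N) = R.trans (Norm-⊛ (P -1ℤ i (d ℕ.* 3) N) (1# ⊕ mono -1ℤ (i ℕ.+ N ℕ.* (d ℕ.* 3)))) (R.*-cong (fin N) (factor N))

-- The factors with exponent prime to 3 form f₁/f₃, which the norm fixes; the others form f₃ =
-- f₁(q³), whose norm is f₁³.
Norm-f₁ : Norm f₁ ⊛ f₃ ≈ f₁ ⊛ f₁ ⊛ f₁ ⊛ f₁
Norm-f₁ = begin
  Norm f₁ ⊛ f₃
    ≈⟨ ⊛-congˡ f₃ (Norm-cong f₁-3) ⟩
  Norm (a ⊛ b ⊛ V f₁) ⊛ f₃
    ≈⟨ ⊛-congˡ f₃ (R.trans (Norm-⊛ (a ⊛ b) (V f₁)) (R.*-cong (R.trans (Norm-⊛ a b)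
         (R.*-cong (Norm-P∞ res₁ 0 1) (Norm-P∞ res₂ 0 1))) (Norm-V f₁))) ⟩
  a ⊛ b ⊛ (f₁ ⊛ f₁ ⊛ f₁) ⊛ f₃
    ≈⟨ solve 4 (λ a b f e → a :* b :* (f :* f :* f) :* e := f :* f :* f :* (a :* b :* e)) R.refl a b f₁ f₃ ⟩
  f₁ ⊛ f₁ ⊛ f₁ ⊛ (a ⊛ b ⊛ f₃)
    ≈⟨ ⊛-congʳ (f₁ ⊛ f₁ ⊛ f₁) (P∞-3 1 1 -1ℤ) ⟨
  f₁ ⊛ f₁ ⊛ f₁ ⊛ f₁ ∎
  where
  open ≈-Reasoning
  open Solver
  a b : Series
  a = P∞ -1ℤ 1 3
  b = P∞ -1ℤ 2 3
  f₁-3 : f₁ ≈ a ⊛ b ⊛ V f₁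
  f₁-3 = R.trans (P∞-3 1 1 -1ℤ) (⊛-congʳ (a ⊛ b) (R.sym (V-P∞ 1 1 -1ℤ)))

Norm-f₂ : Norm f₂ ⊛ f₆ ≈ f₂ ⊛ f₂ ⊛ f₂ ⊛ f₂
Norm-f₂ = begin
  Norm f₂ ⊛ f₆
    ≈⟨ ⊛-congˡ f₆ (Norm-cong f₂-3) ⟩
  Norm (a ⊛ b ⊛ V f₂) ⊛ f₆
    ≈⟨ ⊛-congˡ f₆ (R.trans (Norm-⊛ (a ⊛ b) (V f₂)) (R.*-cong (R.trans (Norm-⊛ a b)
         (R.*-cong (Norm-P∞ res₂ 0 2) (Norm-P∞ res₁ 1 2))) (Norm-V f₂))) ⟩
  a ⊛ b ⊛ (f₂ ⊛ f₂ ⊛ f₂) ⊛ f₆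
    ≈⟨ solve 4 (λ a b f e → a :* b :* (f :* f :* f) :* e := f :* f :* f :* (a :* b :* e)) R.refl a b f₂ f₆ ⟩
  f₂ ⊛ f₂ ⊛ f₂ ⊛ (a ⊛ b ⊛ f₆)
    ≈⟨ ⊛-congʳ (f₂ ⊛ f₂ ⊛ f₂) (P∞-3 2 2 -1ℤ) ⟨
  f₂ ⊛ f₂ ⊛ f₂ ⊛ f₂ ∎
  where
  open ≈-Reasoning
  open Solver
  a b : Series
  a = P∞ -1ℤ 2 6
  b = P∞ -1ℤ 4 6
  f₂-3 : f₂ ≈ a ⊛ b ⊛ V f₂
  f₂-3 = R.trans (P∞-3 2 2 -1ℤ) (⊛-congʳ (a ⊛ b) (R.sym (V-P∞ 2 2 -1ℤ)))

Norm-h : Norm h ⊛ g ≈ h ⊛ h ⊛ h ⊛ h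
Norm-h = begin
  Norm h ⊛ g
    ≈⟨ ⊛-congˡ g (Norm-⊛ f₁ f₂) ⟩
  Norm f₁ ⊛ Norm f₂ ⊛ (f₃ ⊛ f₆)
    ≈⟨ solve 4 (λ a b c d → a :* b :* (c :* d) := a :* c :* (b :* d)) R.refl (Norm f₁) (Norm f₂) f₃ f₆ ⟩
  Norm f₁ ⊛ f₃ ⊛ (Norm f₂ ⊛ f₆)
    ≈⟨ R.*-cong Norm-f₁ Norm-f₂ ⟩
  f₁ ⊛ f₁ ⊛ f₁ ⊛ f₁ ⊛ (f₂ ⊛ f₂ ⊛ f₂ ⊛ f₂)
    ≈⟨ solve 2 (λ a b → a :* a :* a :* a :* (b :* b :* b :* b) := (a :* b) :* (a :* b) :* (a :* b) :* (a :* b)) R.refl f₁ f₂ ⟩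
  h ⊛ h ⊛ h ⊛ h ∎
  where
  open ≈-Reasoning
  open Solver

-- The outer coefficients, read in q, of the product of `φ-3` and `ψ-3`; they are the series a and c
-- of the overview.
h₀ h₂ : Series
h₀ = V φ ⊛ A
h₂ = ⊖ (const (+ 2) ⊛ (Ω ⊛ V ψ))

h₀-h₂ : h₀ ⊛ h₂ ≈ ⊖ (const (+ 2) ⊛ (g ⊛ g))
h₀-h₂ = begin
  V φ ⊛ A ⊛ ⊖ (const (+ 2) ⊛ (Ω ⊛ V ψ))
    ≈⟨ solve 4 (λ p a o s → p :* a :* (:- (con (+ 2) :* (o :* s))) := :- (con (+ 2) :* ((p :* s) :* (o :* a)))) R.refl (V φ) A Ω (V ψ) ⟩
  ⊖ (const (+ 2) ⊛ ((V φ ⊛ V ψ) ⊛ (Ω ⊛ A)))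
    ≈⟨ R.-‿cong (⊛-congʳ (const (+ 2)) (R.*-cong (R.trans (R.sym (V-⊛ φ ψ)) (R.trans (V-cong φ-ψ) V-h)) Ω-A)) ⟩
  ⊖ (const (+ 2) ⊛ (g ⊛ g)) ∎
  where
  open ≈-Reasoning
  open Solver

h-dissected : h ≈ dissected h₀ (⊖ g) h₂
h-dissected = begin
  h
    ≈⟨ φ-ψ ⟨
  φ ⊛ ψ
    ≈⟨ R.*-cong φ-3 ψ-3 ⟩
  (V (V φ) ⊕ ⊖ (const (+ 2) ⊛ q ⊛ V Ω)) ⊛ (V A ⊕ q ⊛ V (V ψ))
    ≈⟨ solve 5 (λ q p o a s → (p :- con (+ 2) :* q :* o) :* (a :+ q :* s) :=
         p :* a :+ q :* (p :* s :- con (+ 2) :* (o :* a)) :+ q :* q :* (:- (con (+ 2) :* (o :* s)))) R.refl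
         q (V (V φ)) (V Ω) (V A) (V (V ψ)) ⟩
  V (V φ) ⊛ V A ⊕ q ⊛ (V (V φ) ⊛ V (V ψ) ⊕ ⊖ (const (+ 2) ⊛ (V Ω ⊛ V A))) ⊕ q ⊛ q ⊛ ⊖ (const (+ 2) ⊛ (V Ω ⊛ V (V ψ)))
    ≈⟨ R.+-cong (R.+-cong (R.sym (V-⊛ (V φ) A)) (⊛-congʳ q middle)) (⊛-congʳ (q ⊛ q) (R.sym last)) ⟩
  dissected h₀ (⊖ g) h₂ ∎
  where
  open ≈-Reasoning
  open Solver
  -- Both products are g(q³), one as h(q⁹) and one as (ΩA)(q³), so the middle coefficient is g - 2g.
  middle : V (V φ) ⊛ V (V ψ) ⊕ ⊖ (const (+ 2) ⊛ (V Ω ⊛ V A)) ≈ V (⊖ g)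
  middle = begin
    V (V φ) ⊛ V (V ψ) ⊕ ⊖ (const (+ 2) ⊛ (V Ω ⊛ V A))
      ≈⟨ R.+-cong
           (R.trans (R.sym (V-⊛ (V φ) (V ψ))) (V-cong (R.trans (R.sym (V-⊛ φ ψ)) (R.trans (V-cong φ-ψ) V-h))))
           (R.-‿cong (⊛-congʳ (const (+ 2)) (R.trans (R.sym (V-⊛ Ω A)) (V-cong Ω-A)))) ⟩
    V g ⊕ ⊖ (const (+ 2) ⊛ V g)
      ≈⟨ solve 1 (λ g → g :- con (+ 2) :* g := :- g) R.refl (V g) ⟩
    ⊖ V g
      ≈⟨ V-⊖ g ⟨
    V (⊖ g) ∎
  last : V h₂ ≈ ⊖ (const (+ 2) ⊛ (V Ω ⊛ V (V ψ)))
  last = R.trans (V-⊖ (const (+ 2) ⊛ (Ω ⊛ V ψ))) (R.-‿cong (R.trans (V-⊛ (const (+ 2)) (Ω ⊛ V ψ))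
    (R.*-cong (V-const (+ 2)) (V-⊛ Ω (V ψ)))))

-- The action of U₃

-- adj is the product h(ωq) h(ω²q) of the conjugates of h, where ω³ = 1.
√K K G S adj₀ adj₁ adj₂ adj : Series
√K = inv h ⊛ (g ⊛ g ⊛ g)
K = √K ⊛ √K
G = q ⊛ (q ⊛ K)
S = q ⊛ (h ⊛ h) ⊛ (g ⊛ g)
adj₀ = h₀ ⊛ h₀ ⊕ q ⊛ (g ⊛ h₂)
adj₁ = q ⊛ (h₂ ⊛ h₂) ⊕ h₀ ⊛ g
adj₂ = g ⊛ g ⊕ ⊖ (h₀ ⊛ h₂)
adj = dissected adj₀ adj₁ adj₂

h-head : h 0 ≡ 1ℤ
h-head = head-⊛ {f₁} {f₂} (η-head 1) (η-head 2)

K-h² : K ⊛ (h ⊛ h) ≈ (g ⊛ g ⊛ g) ⊛ (g ⊛ g ⊛ g)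
K-h² = begin
  K ⊛ (h ⊛ h)
    ≈⟨ solve 3 (λ i g h → i :* g :* (i :* g) :* (h :* h) := (h :* i) :* (h :* i) :* (g :* g)) R.refl (inv h) (g ⊛ g ⊛ g) h ⟩
  (h ⊛ inv h) ⊛ (h ⊛ inv h) ⊛ ((g ⊛ g ⊛ g) ⊛ (g ⊛ g ⊛ g))
    ≈⟨ ⊛-congˡ ((g ⊛ g ⊛ g) ⊛ (g ⊛ g ⊛ g)) (R.*-cong (⊛-inverseʳ h-head) (⊛-inverseʳ h-head)) ⟩
  1# ⊛ 1# ⊛ ((g ⊛ g ⊛ g) ⊛ (g ⊛ g ⊛ g))
    ≈⟨ solve 1 (λ g → con 1ℤ :* con 1ℤ :* g := g) R.refl ((g ⊛ g ⊛ g) ⊛ (g ⊛ g ⊛ g)) ⟩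
  (g ⊛ g ⊛ g) ⊛ (g ⊛ g ⊛ g) ∎
  where
  open ≈-Reasoning
  open Solver

νh : Series
νh = ν h₀ (⊖ g) h₂

νh-g : νh ⊛ g ≈ h ⊛ h ⊛ h ⊛ h
νh-g = R.trans (⊛-congˡ g (R.sym (Norm-dissected h₀ (⊖ g) h₂ h-dissected))) Norm-h

-- The product of all three conjugates is invariant under q ↦ ωq, so components 1 and 2 cancel and
-- component 0 is the norm.
h-adj : h ⊛ adj ≈ V νh
h-adj = begin
  h ⊛ adj
    ≈⟨ ⊛-congˡ adj h-dissected ⟩
  dissected h₀ (⊖ g) h₂ ⊛ adj
    ≈⟨ dissected-⊛ h₀ (⊖ g) h₂ adj₀ adj₁ adj₂ ⟩
  dissected (h₀ ⊛ adj₀ ⊕ q ⊛ (⊖ g ⊛ adj₂ ⊕ h₂ ⊛ adj₁)) (h₀ ⊛ adj₁ ⊕ ⊖ g ⊛ adj₀ ⊕ q ⊛ (h₂ ⊛ adj₂))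
            (h₀ ⊛ adj₂ ⊕ ⊖ g ⊛ adj₁ ⊕ h₂ ⊛ adj₀)
    ≈⟨ dissected-cong
         (solve 4 (λ q a g c →
           a :* (a :* a :+ q :* (g :* c)) :+ q :* ((:- g) :* (g :* g :- a :* c) :+ c :* (q :* (c :* c) :+ a :* g)) :=
           a :* a :* a :+ q :* ((:- g) :* (:- g) :* (:- g)) :+ q :* q :* (c :* c :* c) :- con (+ 3) :* q :* (a :* (:- g) :* c))
           R.refl q h₀ g h₂)
         (solve 4 (λ q a g c →
           a :* (q :* (c :* c) :+ a :* g) :+ (:- g) :* (a :* a :+ q :* (g :* c)) :+ q :* (c :* (g :* g :- a :* c)) := con 0ℤ)
           R.refl q h₀ g h₂)
         (solve 4 (λ q a g c →
           a :* (g :* g :- a :* c) :+ (:- g) :* (q :* (c :* c) :+ a :* g) :+ c :* (a :* a :+ q :* (g :* c)) := con 0ℤ)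
           R.refl q h₀ g h₂) ⟩
  dissected νh 0# 0#
    ≈⟨ R.+-cong (⊕-congʳ (V νh) (⊛-congʳ q (V-const 0ℤ))) (⊛-congʳ (q ⊛ q) (V-const 0ℤ)) ⟩
  V νh ⊕ q ⊛ 0# ⊕ q ⊛ q ⊛ 0#
    ≈⟨ solve 2 (λ νh q → νh :+ q :* con 0ℤ :+ q :* q :* con 0ℤ := νh) R.refl (V νh) q ⟩
  V νh ∎
  where
  open ≈-Reasoning
  open Solver

-- The value of U₃ on q² · `adj`²: component 1 of the square, with the factor q left by the wrap
-- from class 2 to class 0.
adj²₁ : Series
adj²₁ = q ⊛ (adj₀ ⊛ adj₁ ⊕ adj₁ ⊛ adj₀ ⊕ q ⊛ (adj₂ ⊛ adj₂))

U₀-q²adj² : U 0 (q ⊛ (q ⊛ (adj ⊛ adj))) ≈ adj²₁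
U₀-q²adj² = R.trans (U₀-q⊛ (q ⊛ (adj ⊛ adj))) (⊛-congʳ q (R.trans (U₂-q⊛ (adj ⊛ adj))
  (R.trans (U-cong 1 (dissected-⊛ adj₀ adj₁ adj₂ adj₀ adj₁ adj₂)) (U₁-dissected _ _ _))))

-- Rationalising the denominator: multiplication by ν(q³)² = h² · `adj`² turns G into h(q³)⁶ · q² ·
-- `adj`², and both series in q³ pass through U₃.
νh²-U₀G : νh ⊛ νh ⊛ U 0 G ≈ (h ⊛ h ⊛ h) ⊛ (h ⊛ h ⊛ h) ⊛ adj²₁
νh²-U₀G = begin
  νh ⊛ νh ⊛ U 0 G
    ≈⟨ U-V⊛ 0 (s≤s z≤n) (νh ⊛ νh) G ⟨
  U 0 (V (νh ⊛ νh) ⊛ G)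
    ≈⟨ U-cong 0 (begin
         V (νh ⊛ νh) ⊛ G
           ≈⟨ ⊛-congˡ G (R.trans (V-⊛ νh νh) (R.*-cong (R.sym h-adj) (R.sym h-adj))) ⟩
         h ⊛ adj ⊛ (h ⊛ adj) ⊛ (q ⊛ (q ⊛ K))
           ≈⟨ solve 4 (λ h a q k → h :* a :* (h :* a) :* (q :* (q :* k)) := k :* (h :* h) :* (q :* (q :* (a :* a)))) R.refl h adj q K ⟩
         K ⊛ (h ⊛ h) ⊛ (q ⊛ (q ⊛ (adj ⊛ adj)))
           ≈⟨ ⊛-congˡ (q ⊛ (q ⊛ (adj ⊛ adj))) (R.trans K-h² (R.sym V-h⁶)) ⟩
         V ((h ⊛ h ⊛ h) ⊛ (h ⊛ h ⊛ h)) ⊛ (q ⊛ (q ⊛ (adj ⊛ adj))) ∎) ⟩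
  U 0 (V ((h ⊛ h ⊛ h) ⊛ (h ⊛ h ⊛ h)) ⊛ (q ⊛ (q ⊛ (adj ⊛ adj))))
    ≈⟨ U-V⊛ 0 (s≤s z≤n) ((h ⊛ h ⊛ h) ⊛ (h ⊛ h ⊛ h)) (q ⊛ (q ⊛ (adj ⊛ adj))) ⟩
  (h ⊛ h ⊛ h) ⊛ (h ⊛ h ⊛ h) ⊛ U 0 (q ⊛ (q ⊛ (adj ⊛ adj)))
    ≈⟨ ⊛-congʳ ((h ⊛ h ⊛ h) ⊛ (h ⊛ h ⊛ h)) U₀-q²adj² ⟩
  (h ⊛ h ⊛ h) ⊛ (h ⊛ h ⊛ h) ⊛ adj²₁ ∎
  where
  open ≈-Reasoning
  open Solver
  V-h³ : V (h ⊛ h ⊛ h) ≈ g ⊛ g ⊛ g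
  V-h³ = R.trans (V-⊛ (h ⊛ h) h) (R.*-cong (R.trans (V-⊛ h h) (R.*-cong V-h V-h)) V-h)
  V-h⁶ : V ((h ⊛ h ⊛ h) ⊛ (h ⊛ h ⊛ h)) ≈ (g ⊛ g ⊛ g) ⊛ (g ⊛ g ⊛ g)
  V-h⁶ = R.trans (V-⊛ (h ⊛ h ⊛ h) (h ⊛ h ⊛ h)) (R.*-cong V-h³ V-h³)

-- Multiplying by g² replaces ν² by h⁸, and h⁶ cancels.
h²-U₀G : h ⊛ h ⊛ U 0 G ≈ g ⊛ g ⊛ adj²₁
h²-U₀G = ⊛-cancel {(h ⊛ h ⊛ h) ⊛ (h ⊛ h ⊛ h)} (head-⊛ {h ⊛ h ⊛ h} {h ⊛ h ⊛ h} h³ h³) (begin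
  (h ⊛ h ⊛ h) ⊛ (h ⊛ h ⊛ h) ⊛ (h ⊛ h ⊛ U 0 G)
    ≈⟨ solve 2 (λ h u → h :* h :* h :* (h :* h :* h) :* (h :* h :* u) := (h :* h :* h :* h) :* (h :* h :* h :* h) :* u) R.refl h (U 0 G) ⟩
  (h ⊛ h ⊛ h ⊛ h) ⊛ (h ⊛ h ⊛ h ⊛ h) ⊛ U 0 G
    ≈⟨ ⊛-congˡ (U 0 G) (R.*-cong νh-g νh-g) ⟨
  νh ⊛ g ⊛ (νh ⊛ g) ⊛ U 0 G
    ≈⟨ solve 3 (λ νh g u → νh :* g :* (νh :* g) :* u := g :* g :* (νh :* νh :* u)) R.refl νh g (U 0 G) ⟩
  g ⊛ g ⊛ (νh ⊛ νh ⊛ U 0 G)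
    ≈⟨ ⊛-congʳ (g ⊛ g) νh²-U₀G ⟩
  g ⊛ g ⊛ ((h ⊛ h ⊛ h) ⊛ (h ⊛ h ⊛ h) ⊛ adj²₁)
    ≈⟨ solve 3 (λ g h e → g :* (h :* e) := h :* (g :* e)) R.refl (g ⊛ g) ((h ⊛ h ⊛ h) ⊛ (h ⊛ h ⊛ h)) adj²₁ ⟩
  (h ⊛ h ⊛ h) ⊛ (h ⊛ h ⊛ h) ⊛ (g ⊛ g ⊛ adj²₁) ∎)
  where
  open ≈-Reasoning
  open Solver
  h³ : (h ⊛ h ⊛ h) 0 ≡ 1ℤ
  h³ = head-⊛ {h ⊛ h} {h} (head-⊛ {h} {h} h-head h-head) h-head

-- The constant is 27 = 13 + 14. The part 3(ac)² + g⁴ becomes 13g⁴ by ac = -2g². The same relation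
-- gives a³ + q²c³ = ν + 7qg³, and this sum occurs with the factor 2g.
adj²₁-value : adj²₁ ≈ const (+ 27) ⊛ (q ⊛ q ⊛ (g ⊛ g ⊛ g ⊛ g)) ⊕ const (+ 2) ⊛ (q ⊛ (g ⊛ νh))
adj²₁-value = begin
  adj²₁
    ≈⟨ solve 4 (λ q a g c →
         q :* ((a :* a :+ q :* (g :* c)) :* (q :* (c :* c) :+ a :* g) :+ (q :* (c :* c) :+ a :* g) :* (a :* a :+ q :* (g :* c)) :+
           q :* ((g :* g :- a :* c) :* (g :* g :- a :* c))) :=
         q :* (con (+ 2) :* (g :* (a :* a :* a :+ q :* q :* (c :* c :* c))) :+
           q :* (con (+ 3) :* ((a :* c) :* (a :* c)) :+ g :* g :* g :* g))) R.refl q h₀ g h₂ ⟩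
  q ⊛ (const (+ 2) ⊛ (g ⊛ (h₀ ⊛ h₀ ⊛ h₀ ⊕ q ⊛ q ⊛ (h₂ ⊛ h₂ ⊛ h₂))) ⊕
    q ⊛ (const (+ 3) ⊛ ((h₀ ⊛ h₂) ⊛ (h₀ ⊛ h₂)) ⊕ g ⊛ g ⊛ g ⊛ g))
    ≈⟨ ⊛-congʳ q (⊕-congʳ (const (+ 2) ⊛ (g ⊛ (h₀ ⊛ h₀ ⊛ h₀ ⊕ q ⊛ q ⊛ (h₂ ⊛ h₂ ⊛ h₂)))) (⊛-congʳ q (⊕-congˡ (g ⊛ g ⊛ g ⊛ g)
         (⊛-congʳ (const (+ 3)) (R.*-cong h₀-h₂ h₀-h₂))))) ⟩
  q ⊛ (const (+ 2) ⊛ (g ⊛ (h₀ ⊛ h₀ ⊛ h₀ ⊕ q ⊛ q ⊛ (h₂ ⊛ h₂ ⊛ h₂))) ⊕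
    q ⊛ (const (+ 3) ⊛ (⊖ (const (+ 2) ⊛ (g ⊛ g)) ⊛ ⊖ (const (+ 2) ⊛ (g ⊛ g))) ⊕ g ⊛ g ⊛ g ⊛ g))
    ≈⟨ solve 4 (λ q a g c →
         q :* (con (+ 2) :* (g :* (a :* a :* a :+ q :* q :* (c :* c :* c))) :+
           q :* (con (+ 3) :* ((:- (con (+ 2) :* (g :* g))) :* (:- (con (+ 2) :* (g :* g)))) :+ g :* g :* g :* g)) :=
         con (+ 27) :* (q :* q :* (g :* g :* g :* g)) :+
         con (+ 2) :* (q :* (g :* (a :* a :* a :- q :* (g :* g :* g) :+ q :* q :* (c :* c :* c) :+
           con (+ 3) :* q :* (g :* (:- (con (+ 2) :* (g :* g)))))))) R.refl q h₀ g h₂ ⟩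
  const (+ 27) ⊛ (q ⊛ q ⊛ (g ⊛ g ⊛ g ⊛ g)) ⊕
  const (+ 2) ⊛ (q ⊛ (g ⊛ (h₀ ⊛ h₀ ⊛ h₀ ⊕ ⊖ (q ⊛ (g ⊛ g ⊛ g)) ⊕ q ⊛ q ⊛ (h₂ ⊛ h₂ ⊛ h₂) ⊕
    const (+ 3) ⊛ q ⊛ (g ⊛ ⊖ (const (+ 2) ⊛ (g ⊛ g))))))
    ≈⟨ ⊕-congʳ (const (+ 27) ⊛ (q ⊛ q ⊛ (g ⊛ g ⊛ g ⊛ g))) (⊛-congʳ (const (+ 2)) (⊛-congʳ q (⊛-congʳ g (R.trans
         (⊕-congʳ (h₀ ⊛ h₀ ⊛ h₀ ⊕ ⊖ (q ⊛ (g ⊛ g ⊛ g)) ⊕ q ⊛ q ⊛ (h₂ ⊛ h₂ ⊛ h₂))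
           (⊛-congʳ (const (+ 3) ⊛ q) (⊛-congʳ g (R.sym h₀-h₂))))
         (solve 4 (λ q a g c →
           a :* a :* a :- q :* (g :* g :* g) :+ q :* q :* (c :* c :* c) :+ con (+ 3) :* q :* (g :* (a :* c)) :=
           a :* a :* a :+ q :* ((:- g) :* (:- g) :* (:- g)) :+ q :* q :* (c :* c :* c) :- con (+ 3) :* q :* (a :* (:- g) :* c))
           R.refl q h₀ g h₂))))) ⟩
  const (+ 27) ⊛ (q ⊛ q ⊛ (g ⊛ g ⊛ g ⊛ g)) ⊕ const (+ 2) ⊛ (q ⊛ (g ⊛ νh)) ∎
  where
  open ≈-Reasoning
  open Solver

U₀-G : U 0 G ≈ const (+ 27) ⊛ G ⊕ const (+ 2) ⊛ S
U₀-G = ⊛-cancel (head-⊛ {h} {h} h-head h-head) (begin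
  h ⊛ h ⊛ U 0 G
    ≈⟨ h²-U₀G ⟩
  g ⊛ g ⊛ adj²₁
    ≈⟨ ⊛-congʳ (g ⊛ g) adj²₁-value ⟩
  g ⊛ g ⊛ (const (+ 27) ⊛ (q ⊛ q ⊛ (g ⊛ g ⊛ g ⊛ g)) ⊕ const (+ 2) ⊛ (q ⊛ (g ⊛ νh)))
    ≈⟨ solve 3 (λ g q νh →
         g :* g :* (con (+ 27) :* (q :* q :* (g :* g :* g :* g)) :+ con (+ 2) :* (q :* (g :* νh))) :=
         con (+ 27) :* (q :* q :* (g :* g :* g :* (g :* g :* g))) :+ con (+ 2) :* (q :* (g :* g) :* (νh :* g))) R.refl g q νh ⟩
  const (+ 27) ⊛ (q ⊛ q ⊛ ((g ⊛ g ⊛ g) ⊛ (g ⊛ g ⊛ g))) ⊕ const (+ 2) ⊛ (q ⊛ (g ⊛ g) ⊛ (νh ⊛ g))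
    ≈⟨ R.+-cong (⊛-congʳ (const (+ 27)) (⊛-congʳ (q ⊛ q) (R.sym K-h²))) (⊛-congʳ (const (+ 2)) (⊛-congʳ (q ⊛ (g ⊛ g)) νh-g)) ⟩
  const (+ 27) ⊛ (q ⊛ q ⊛ (K ⊛ (h ⊛ h))) ⊕ const (+ 2) ⊛ (q ⊛ (g ⊛ g) ⊛ (h ⊛ h ⊛ h ⊛ h))
    ≈⟨ solve 4 (λ h q k g →
         con (+ 27) :* (q :* q :* (k :* (h :* h))) :+ con (+ 2) :* (q :* (g :* g) :* (h :* h :* h :* h)) :=
         h :* h :* (con (+ 27) :* (q :* (q :* k)) :+ con (+ 2) :* (q :* (h :* h) :* (g :* g)))) R.refl h q K g ⟩
  h ⊛ h ⊛ (const (+ 27) ⊛ G ⊕ const (+ 2) ⊛ S) ∎)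
  where
  open ≈-Reasoning
  open Solver

-- Since g² = h(q³)², only component 2 of h² matters: it is 2ac + g² = -4g² + g² = -3g².
U₀-S : U 0 S ≈ const -[1+ 2 ] ⊛ S
U₀-S = begin
  U 0 S
    ≈⟨ U-cong 0 (R.trans (R.*-comm (q ⊛ (h ⊛ h)) (g ⊛ g))
         (⊛-congˡ (q ⊛ (h ⊛ h)) (R.sym (R.trans (V-⊛ h h) (R.*-cong V-h V-h))))) ⟩
  U 0 (V (h ⊛ h) ⊛ (q ⊛ (h ⊛ h)))
    ≈⟨ U-V⊛ 0 (s≤s z≤n) (h ⊛ h) (q ⊛ (h ⊛ h)) ⟩
  h ⊛ h ⊛ U 0 (q ⊛ (h ⊛ h))
    ≈⟨ ⊛-congʳ (h ⊛ h) (R.trans (U₀-q⊛ (h ⊛ h)) (⊛-congʳ q (R.trans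
         (U-cong 2 (R.trans (R.*-cong h-dissected h-dissected) (dissected-⊛ h₀ (⊖ g) h₂ h₀ (⊖ g) h₂)))
         (U₂-dissected _ _ _)))) ⟩
  h ⊛ h ⊛ (q ⊛ (h₀ ⊛ h₂ ⊕ ⊖ g ⊛ ⊖ g ⊕ h₂ ⊛ h₀))
    ≈⟨ ⊛-congʳ (h ⊛ h) (⊛-congʳ q (R.+-cong (⊕-congˡ (⊖ g ⊛ ⊖ g) h₀-h₂) (R.trans (R.*-comm h₂ h₀) h₀-h₂))) ⟩
  h ⊛ h ⊛ (q ⊛ (⊖ (const (+ 2) ⊛ (g ⊛ g)) ⊕ ⊖ g ⊛ ⊖ g ⊕ ⊖ (const (+ 2) ⊛ (g ⊛ g))))
    ≈⟨ solve 3 (λ h q g →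
         h :* h :* (q :* (:- (con (+ 2) :* (g :* g)) :+ (:- g) :* (:- g) :+ :- (con (+ 2) :* (g :* g)))) :=
         con -[1+ 2 ] :* (q :* (h :* h) :* (g :* g))) R.refl h q g ⟩
  const -[1+ 2 ] ⊛ S ∎
  where
  open ≈-Reasoning
  open Solver

-- The coefficients CP3

open Exp R.commutativeSemiring using () renaming (_^_ to _↑_; ^-distrib-* to ↑-distrib-⊛)

one≈1# : one ≈ 1#
one≈1# = coeffs λ { zero → refl ; (suc _) → refl }

mulOneMinus-⊛ : ∀ k a → mulOneMinus k a ≈ (1# ⊕ mono -1ℤ k) ⊛ a
mulOneMinus-⊛ k a = coeffs λ i → sym (trans
  (at (R.trans (R.distribʳ a 1# (mono -1ℤ k)) (⊕-congˡ (mono -1ℤ k ⊛ a) (R.*-identityˡ a))) i)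
  (trans (cong (λ w → a i ℤ.+ w) (shift k i)) (push (i <ᵇ k) i)))
  where
  shift : ∀ k i → (mono -1ℤ k ⊛ a) i ≡ (if i <ᵇ k then 0ℤ else ℤ.- a (i ∸ k))
  shift zero i = trans (const-⊛ -1ℤ a i) (ℤₚ.-1*i≡-i (a i))
  shift (suc k) zero = refl
  shift (suc k) (suc i) = trans (mono-⊛-suc -1ℤ k a i) (shift k i)
  push : ∀ b i → a i ℤ.+ (if b then 0ℤ else ℤ.- a (i ∸ k)) ≡ (if b then a i else (a i ℤ.- a (i ∸ k)))
  push true i = ℤₚ.+-identityʳ (a i)
  push false i = refl

private
  foldr-applyUpTo-cong : ∀ {f f' : ℕ → ℤ} n → (∀ j → f j ≡ f' j) →
    foldr ℤ._+_ 0ℤ (applyUpTo f n) ≡ foldr ℤ._+_ 0ℤ (applyUpTo f' n)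
  foldr-applyUpTo-cong zero p = refl
  foldr-applyUpTo-cong (suc n) p = cong₂ ℤ._+_ (p 0) (foldr-applyUpTo-cong n (p ∘ suc))

-- Dropping the first summand of the geometric sum at i leaves the geometric sum at i - (k+1), so
-- multiplication by 1 - q^(k+1) telescopes.
⊛-divOneMinus : ∀ k a → (1# ⊕ mono -1ℤ (suc k)) ⊛ divOneMinus k a ≈ a
⊛-divOneMinus k a = R.trans (R.sym (mulOneMinus-⊛ (suc k) b)) (coeffs go)
  where
  b : Series
  b = divOneMinus k a
  b-sum : ∀ i → b i ≡ foldr ℤ._+_ 0ℤ (applyUpTo (λ j → a (i ∸ j * suc k)) (suc (i ℕ./ suc k)))
  b-sum i = cong (foldr ℤ._+_ 0ℤ) (Listₚ.map-upTo (λ j → a (i ∸ j * suc k)) (suc (i ℕ./ suc k)))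
  b-small : ∀ i → i < suc k → b i ≡ a i
  b-small i i<k = trans (b-sum i) (trans
    (cong (λ n → foldr ℤ._+_ 0ℤ (applyUpTo (λ j → a (i ∸ j * suc k)) (suc n))) (DivMod.m<n⇒m/n≡0 i<k))
    (ℤₚ.+-identityʳ (a i)))
  b-large : ∀ i → suc k ≤ i → b i ≡ a i ℤ.+ b (i ∸ suc k)
  b-large i k≤i = trans (b-sum i) (trans
    (cong (λ n → foldr ℤ._+_ 0ℤ (applyUpTo (λ j → a (i ∸ j * suc k)) (suc n))) (DivMod.m/n≡1+[m∸n]/n k≤i))
    (cong (λ w → a i ℤ.+ w) (trans
      (foldr-applyUpTo-cong (suc ((i ∸ suc k) ℕ./ suc k)) (λ j → cong a (sym (ℕₚ.∸-+-assoc i (suc k) (j * suc k)))))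
      (sym (b-sum (i ∸ suc k))))))
  go : ∀ i → mulOneMinus (suc k) b i ≡ a i
  go i with i <ᵇ suc k in eq
  ... | true = b-small i (ℕₚ.<ᵇ⇒< i (suc k) (subst T (sym eq) _))
  ... | false = trans (cong (λ w → w ℤ.- b (i ∸ suc k)) (b-large i (ℕₚ.≮⇒≥ λ i<k → subst T eq (ℕₚ.<⇒<ᵇ i<k))))
    (solve 2 (λ x y → x :+ y :- y := x) refl (a i) (b (i ∸ suc k)))
    where open ℤSolver

iter-⊛ : ∀ e x {f} → (∀ a → f a ≈ x ⊛ a) → ∀ s → iter e f s ≈ x ↑ e ⊛ s
iter-⊛ zero x p s = R.sym (R.*-identityˡ s)
iter-⊛ (suc e) x {f} p s = R.trans (p (iter e f s)) (R.trans (⊛-congʳ x (iter-⊛ e x p s)) (R.sym (R.*-assoc x (x ↑ e) s)))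

⊛-iter : ∀ e x {f} → (∀ a → x ⊛ f a ≈ a) → ∀ s → x ↑ e ⊛ iter e f s ≈ s
⊛-iter zero x p s = R.*-identityˡ s
⊛-iter (suc e) x {f} p s = begin
  x ⊛ x ↑ e ⊛ f (iter e f s)   ≈⟨ solve 3 (λ x y z → x :* y :* z := y :* (x :* z)) R.refl x (x ↑ e) (f (iter e f s)) ⟩
  x ↑ e ⊛ (x ⊛ f (iter e f s)) ≈⟨ ⊛-congʳ (x ↑ e) (p (iter e f s)) ⟩
  x ↑ e ⊛ iter e f s           ≈⟨ ⊛-iter e x p s ⟩
  s                            ∎
  where
  open ≈-Reasoning
  open Solver

-- The fold applies its last factor first, whereas `P` is built by appending factors; this matches
-- the two recursions.
foldr-upTo-suc : ∀ (f : ℕ → Series → Series) s N → foldr f s (upTo (suc N)) ≡ foldr f (f N s) (upTo N)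
foldr-upTo-suc f s N = trans (cong (foldr f s) (sym (Listₚ.upTo-∷ʳ N))) (Listₚ.foldr-∷ʳ f s N (upTo N))

1↑ : ∀ e → 1# ↑ e ≈ 1#
1↑ zero = R.refl
1↑ (suc e) = R.trans (R.*-identityˡ (1# ↑ e)) (1↑ e)

mulEta-⊛ : ∀ N m e s → mulEta N m e s ≈ P -1ℤ m m N ↑ e ⊛ s
mulEta-⊛ zero m e s = R.sym (R.trans (⊛-congˡ s (1↑ e)) (R.*-identityˡ s))
mulEta-⊛ (suc N) m e s = begin
  mulEta (suc N) m e s
    ≈⟨ ≡⇒≈ (foldr-upTo-suc (λ n → iter e (mulOneMinus (suc n * m))) s N) ⟩
  mulEta N m e s'
    ≈⟨ mulEta-⊛ N m e s' ⟩
  p ↑ e ⊛ s'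
    ≈⟨ ⊛-congʳ (p ↑ e) (iter-⊛ e x (mulOneMinus-⊛ (suc N * m)) s) ⟩
  p ↑ e ⊛ (x ↑ e ⊛ s)
    ≈⟨ R.*-assoc (p ↑ e) (x ↑ e) s ⟨
  p ↑ e ⊛ x ↑ e ⊛ s
    ≈⟨ ⊛-congˡ s (↑-distrib-⊛ p x e) ⟨
  (p ⊛ x) ↑ e ⊛ s ∎
  where
  open ≈-Reasoning
  p x s' : Series
  p = P -1ℤ m m N
  x = 1# ⊕ mono -1ℤ (suc N * m)
  s' = iter e (mulOneMinus (suc N * m)) s

⊛-divEta : ∀ N m e s → P -1ℤ (suc m) (suc m) N ↑ e ⊛ divEta N m e s ≈ s
⊛-divEta zero m e s = R.trans (⊛-congˡ s (1↑ e)) (R.*-identityˡ s)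
⊛-divEta (suc N) m e s = begin
  (p ⊛ x) ↑ e ⊛ divEta (suc N) m e s
    ≈⟨ R.*-cong (↑-distrib-⊛ p x e) (≡⇒≈ (foldr-upTo-suc (λ n → iter e (divOneMinus (suc n * suc m ∸ 1))) s N)) ⟩
  p ↑ e ⊛ x ↑ e ⊛ divEta N m e s'
    ≈⟨ solve 3 (λ p x d → p :* x :* d := x :* (p :* d)) R.refl (p ↑ e) (x ↑ e) (divEta N m e s') ⟩
  x ↑ e ⊛ (p ↑ e ⊛ divEta N m e s')
    ≈⟨ ⊛-congʳ (x ↑ e) (⊛-divEta N m e s') ⟩
  x ↑ e ⊛ s'
    ≈⟨ ⊛-iter e x (⊛-divOneMinus (m + N * suc m)) s ⟩
  s ∎
  where
  open ≈-Reasoning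
  open Solver
  p x s' : Series
  p = P -1ℤ (suc m) (suc m) N
  x = 1# ⊕ mono -1ℤ (suc N * suc m)
  s' = iter e (divOneMinus (suc N * suc m ∸ 1)) s

-- One power of q better than `P-⟶`, because the first omitted factor has exponent (N+1)m ≥ N + 1.
-- `CP3 N` reads coefficient N from products of N factors, so exactly this is needed.
P-sharp : ∀ m .{{_ : NonZero m}} N → P -1ℤ m m N ≈[ suc N ] η m
P-sharp m N = ≈[]-trans
  (≈[]-sym (≈[]0⇒⊛≈[] (mono-small -1ℤ (ℕₚ.m≤m*n (suc N) m))))
  (mod-q^ (P-⟶ -1ℤ m m) (suc N) (suc N) ℕₚ.≤-refl)

CP3≡K : ∀ N → CP3 N ≡ K N
CP3≡K N = at< chain N ℕₚ.≤-refl
  where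
  open Solver
  D₂ D : Series
  D₂ = divEta N 1 2 one
  D = divEta N 0 2 D₂
  p : ℕ → Series
  p m = P -1ℤ m m N
  inverse : p 1 ↑ 2 ⊛ p 2 ↑ 2 ⊛ D ≈ 1#
  inverse = R.trans (solve 3 (λ x y d → x :* y :* d := y :* (x :* d)) R.refl (p 1 ↑ 2) (p 2 ↑ 2) D)
    (R.trans (⊛-congʳ (p 2 ↑ 2) (⊛-divEta N 0 2 D₂)) (R.trans (⊛-divEta N 1 2 one) one≈1#))
  ↑-cong[] : ∀ e {x y M} → x ≈[ M ] y → x ↑ e ≈[ M ] y ↑ e
  ↑-cong[] zero r = ≈[]-refl
  ↑-cong[] (suc e) r = ⊛-cong[] r (↑-cong[] e r)
  chain : mulEta N 3 6 (mulEta N 6 6 D) ≈[ suc N ] K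
  chain =
    ≈[]-trans (≈⇒≈[] (suc N) (R.trans (mulEta-⊛ N 3 6 (mulEta N 6 6 D)) (⊛-congʳ (p 3 ↑ 6) (mulEta-⊛ N 6 6 D))))
    (≈[]-trans (⊛-cong[] (↑-cong[] 6 (P-sharp 3 N)) (⊛-cong[] (↑-cong[] 6 (P-sharp 6 N)) (≈[]-refl {D})))
    (≈[]-trans (≈⇒≈[] (suc N) (R.trans
      (solve 3 (λ x y d → x :^ 6 :* (y :^ 6 :* d) := (x :* y) :* (x :* y) :* (x :* y) :* ((x :* y) :* (x :* y) :* (x :* y)) :* d) R.refl f₃ f₆ D)
      (R.trans (⊛-congˡ D (R.sym K-h²))
        (solve 4 (λ k x y d → k :* (x :* y :* (x :* y)) :* d := k :* (x :^ 2 :* y :^ 2 :* d)) R.refl K f₁ f₂ D))))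
    -- The factor f₁²f₂² introduced by g⁶ = Kh² is truncated again, since `D` is the exact inverse
    -- of the truncated product.
    (≈[]-trans (⊛-cong[] (≈[]-refl {K}) (⊛-cong[] (⊛-cong[]
      (↑-cong[] 2 (≈[]-sym (P-sharp 1 N))) (↑-cong[] 2 (≈[]-sym (P-sharp 2 N)))) (≈[]-refl {D})))
    (≈⇒≈[] (suc N) (R.trans (⊛-congʳ K inverse) (R.*-identityʳ K))))))

square-odd : ∀ a j → + 2 Signed.∣ (a ⊛ a) (1 + j * 2)
square-odd a zero = Signed.divides (a 0 ℤ.* a 1)
  (solve 2 (λ x y → x :* y :+ y :* x := x :* y :* con (+ 2)) refl (a 0) (a 1))
  where open ℤSolver
-- The equal products at the two ends of the convolution are stripped together; at an odd index no
-- middle square remains.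
square-odd a (suc j) = subst (+ 2 Signed.∣_)
  (sym (trans (cong (λ w → a 0 ℤ.* a (3 + j * 2) ℤ.+ w) (⊛-sucʳ (tail a) a (1 + j * 2)))
    (solve 3 (λ x y z → x :* y :+ (y :* x :+ z) := con (+ 2) :* (x :* y) :+ z) refl
      (a 0) (a (3 + j * 2)) ((tail a ⊛ tail a) (1 + j * 2)))))
  (Signed.∣m∣n⇒∣m+n (Signed.∣m⇒∣m*n (a 0 ℤ.* a (3 + j * 2)) Signed.∣-refl) (square-odd (tail a) j))
  where open ℤSolver

G-rec : ∀ m → G (m * 3) ≡ + 27 ℤ.* G m ℤ.+ + 2 ℤ.* S m
G-rec m = trans (cong G (sym (ℕₚ.+-identityʳ (m * 3)))) (trans (at U₀-G m)
  (cong₂ ℤ._+_ (const-⊛ (+ 27) G m) (const-⊛ (+ 2) S m)))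

S-rec : ∀ m → S (m * 3) ≡ -[1+ 2 ] ℤ.* S m
S-rec m = trans (cong S (sym (ℕₚ.+-identityʳ (m * 3)))) (trans (at U₀-S m) (const-⊛ -[1+ 2 ] S m))

*3^suc : ∀ m k → m * 3 ^ suc k ≡ m * 3 ^ k * 3
*3^suc m k = solve 2 (λ m x → m :* (con 3 :* x) := m :* x :* con 3) refl m (3 ^ k)
  where open ℕSolver

3^-∣-suc : ∀ k {x} c → + (3 ^ k) Signed.∣ x → + (3 ^ suc k) Signed.∣ + 3 ℤ.* c ℤ.* x
3^-∣-suc k c (Signed.divides y refl) = Signed.divides (c ℤ.* y)
  (trans (solve 3 (λ c y x → con (+ 3) :* c :* (y :* x) := c :* y :* (con (+ 3) :* x)) refl c y (+ (3 ^ k)))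
    (cong (λ w → c ℤ.* y ℤ.* w) (sym (ℤₚ.pos-* 3 (3 ^ k)))))
  where open ℤSolver

S-∣ : ∀ m k → + (3 ^ k) Signed.∣ S (m * 3 ^ k)
S-∣ m zero = Signed.divides (S (m * 1)) (sym (ℤₚ.*-identityʳ _))
S-∣ m (suc k) = subst (+ (3 ^ suc k) Signed.∣_) (sym (trans (cong S (*3^suc m k)) (S-rec (m * 3 ^ k))))
  (3^-∣-suc k -1ℤ (S-∣ m k))

-- The summand 27G has factors 3 to spare; the summand 2S supplies just the required power, so the
-- induction rests on `S-∣`.
G-∣ : ∀ m k → + (3 ^ k) Signed.∣ G (m * 3 ^ suc k)
G-∣ m zero = Signed.divides (G (m * 3)) (sym (ℤₚ.*-identityʳ _))
G-∣ m (suc k) = subst (+ (3 ^ suc k) Signed.∣_)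
  (sym (trans (cong G (*3^suc m (suc k))) (G-rec (m * 3 ^ suc k))))
  (Signed.∣m∣n⇒∣m+n (3^-∣-suc k (+ 9) (G-∣ m k)) (Signed.∣n⇒∣m*n (+ 2) (S-∣ m (suc k))))

3^-odd : ∀ k → ∃ λ t → 3 ^ k ≡ 1 + t * 2
3^-odd zero = 0 , refl
3^-odd (suc k) with t , eq ← 3^-odd k = 1 + t * 3 , trans (cong (3 *_) eq)
  (solve 1 (λ t → con 3 :* (con 1 :+ t :* con 2) := con 1 :+ (con 1 :+ t :* con 3) :* con 2) refl t)
  where open ℕSolver

-- Coprimality made explicit: with 3ᵏ = 1 + 2t and x = z · 3ᵏ, the cofactor z = x - 2zt is even.
2∧3^⇒2*3^ : ∀ k {x} → + 2 Signed.∣ x → + (3 ^ k) Signed.∣ x → + (2 * 3 ^ k) Signed.∣ x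
2∧3^⇒2*3^ k {x} 2∣x (Signed.divides z x≡z*3^k) = combine (subst (+ 2 Signed.∣_) z≡
    (Signed.∣m∣n⇒∣m-n 2∣x (Signed.∣n⇒∣m*n (z ℤ.* + t) Signed.∣-refl)))
  where
  open ℤSolver
  t : ℕ
  t = proj₁ (3^-odd k)
  3^≡ : + (3 ^ k) ≡ 1ℤ ℤ.+ + t ℤ.* + 2
  3^≡ = trans (cong +_ (proj₂ (3^-odd k))) (cong (λ w → 1ℤ ℤ.+ w) (ℤₚ.pos-* t 2))
  z≡ : x ℤ.- z ℤ.* + t ℤ.* + 2 ≡ z
  z≡ = trans (cong (λ w → w ℤ.- z ℤ.* + t ℤ.* + 2) (trans x≡z*3^k (cong (z ℤ.*_) 3^≡)))
    (solve 2 (λ z t → z :* (con 1ℤ :+ t :* con (+ 2)) :- z :* t :* con (+ 2) := z) refl z (+ t))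
  combine : + 2 Signed.∣ z → + (2 * 3 ^ k) Signed.∣ x
  combine (Signed.divides w z≡w*2) = Signed.divides w (trans x≡z*3^k (trans (cong (ℤ._* + (3 ^ k)) z≡w*2)
    (trans (ℤₚ.*-assoc w (+ 2) (+ (3 ^ k))) (cong (w ℤ.*_) (sym (ℤₚ.pos-* 2 (3 ^ k)))))))

theorem3p9 : ∀ (k n : ℕ) → 1 Data.Nat.≤ k → 1 Data.Nat.≤ n →
    (+ (2 * 3 ^ (k ∸ 1))) ∣ CP3 (2 * 3 ^ k * n + 3 ^ k ∸ 2)
theorem3p9 (suc k) n _ _ = Signed.∣⇒∣ᵤ (2∧3^⇒2*3^ k
  (subst (+ 2 Signed.∣_) (sym (trans (CP3≡K N) (cong K N-odd))) (square-odd √K j))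
  (subst (+ (3 ^ k) Signed.∣_) (trans (cong G m*3^≡) (trans (G-K N) (sym (CP3≡K N)))) (G-∣ m k)))
  where
  open ℕSolver
  N m t j : ℕ
  N = 2 * 3 ^ suc k * n + 3 ^ suc k ∸ 2
  m = 1 + n * 2
  t = proj₁ (3^-odd k)
  -- From 3^(k+1) = 3(1 + 2t) = 2 + (1 + 2 · 3t), which makes N = 1 + 2j; in particular the
  -- subtraction of 2 in N is not truncated.
  j = 3 ^ suc k * n + t * 3
  G-K : ∀ i → G (2 + i) ≡ K i
  G-K i = trans (q⊛-suc (q ⊛ K) (suc i)) (q⊛-suc K i)
  N+2 : 2 * 3 ^ suc k * n + 3 ^ suc k ≡ 2 + (1 + j * 2)
  N+2 = trans (cong (λ w → 2 * 3 ^ suc k * n + w) (cong (3 *_) (proj₂ (3^-odd k))))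
    (solve 3 (λ x n t → con 2 :* x :* n :+ con 3 :* (con 1 :+ t :* con 2) := con 2 :+ (con 1 :+ (x :* n :+ t :* con 3) :* con 2))
      refl (3 ^ suc k) n t)
  N-odd : N ≡ 1 + j * 2
  N-odd = cong (_∸ 2) N+2
  m*3^≡ : m * 3 ^ suc k ≡ 2 + N
  m*3^≡ = trans (solve 2 (λ x n → (con 1 :+ n :* con 2) :* x := con 2 :* x :* n :+ x) refl (3 ^ suc k) n)
    (trans N+2 (cong (λ w → 2 + w) (sym N-odd)))
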